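{- The vertex-Turán density of $Q_6$ is greater than $6/7$. Equivalently, $\gamma_6 < 1/7$.
   Context: Let $Q_n$ denote the $n$-dimensional discrete cube with vertex set $\{0,1\}^n$, two vectors being adjacent if they differ in exactly one coordinate. A copy of $Q_d$ in $Q_n$ is the vertex set of a $d$-dimensional subcube, i.e. a set of the form $\{x \in \{0,1\}^n : x_i = a_i \text{ for all } i \notin I\}$ for some $I \subset [n]$ with $|I| = d$ and some fixed values $a_i \in \{0,1\}$. Let $\mathrm{exc}(n,Q_d)$ be the maximum size of a subset of $\{0,1\}^n$ containing no copy of $Q_d$, and define the vertex-Turán density $\lambda(Q_d) = \lim_{n\to\infty} \mathrm{exc}(n,Q_d)/2^n$ (this limit exists). Let $g(n,d)$ be the minimum size of a subset of $\{0,1\}^n$ that intersects every copy of $Q_d$, and $\gamma_d = \lim_{n\to\infty} g(n,d)/2^n$, so that $\gamma_d = 1 - \lambda(Q_d)$. -}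

module Defs where

open import Data.Nat using (ℕ; zero; suc)
open import Data.Bool using (Bool; true; false)
open import Data.Vec using (Vec; []; _∷_; lookup)
open import Data.List using (List; []; _∷_; _++_; map; length; filterᵇ)
open import Data.Fin using (Fin)
open import Data.Fin.Subset using (Subset; _∉_; ∣_∣)
open import Data.Product using (Σ; _×_; ∃)
open import Relation.Binary.PropositionalEquality using (_≡_)
open import Relation.Nullary using (¬_)

Vertex : ℕ → Set
Vertex n = Vec Bool n

allVertices : (n : ℕ) → List (Vertex n)
allVertices zero = [] ∷ []
allVertices (suc n) = map (false ∷_) (allVertices n) ++ map (true ∷_) (allVertices n)

VSet : ℕ → Set
VSet n = Vertex n → Bool

size : {n : ℕ} → VSet n → ℕ
size {n} S = length (filterᵇ S (allVertices n))

InSubcube : {n : ℕ} → Subset n → Vertex n → Vertex n → Set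
InSubcube I a x = ∀ i → i ∉ I → lookup x i ≡ lookup a i

ContainsCopy : {n : ℕ} → (d : ℕ) → VSet n → Set
ContainsCopy {n} d S =
  Σ (Subset n) λ I → Σ (Vertex n) λ a →
    (∣ I ∣ ≡ d) × (∀ x → InSubcube I a x → S x ≡ true)

QdFree : {n : ℕ} → (d : ℕ) → VSet n → Set
QdFree d S = ¬ ContainsCopy d S

{-# OPTIONS --safe #-}
module Submission where

-- Choose n + 4 random rows over the field 𝔽 with three elements, and for a set X of columns let ν t X be the
-- dimension of the space of vectors supported on X that are orthogonal to the first t rows.  In every third
-- layer |X| = t keep only the X with ν t X = 0, or with ν t X = 2 and ν (t + 2) X = 0; in the layer |X| = t - 2
-- discard the X with ν t X = 2 and ν (t + 2) X = 0; keep everything else.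
--
-- A copy of Q₆ has such a layer t in one of its positions 2, 3, 4.  A single exchange changes ν t by at most
-- one, so in that layer either all sets have ν t = 0 or all have ν t = 2 and ν (t + 2) = 0.  The first case
-- makes U₂,₆, U₃,₆ or U₄,₆ a ternary matroid, which none of them is.  In the second case, either the first
-- t + 2 rows again give such a ternary matroid, or the kernel of the first t rows vanishes on the free
-- coordinates, and then the copy contains a discarded set of size t - 2.
--
-- As rows are added, ν drops from m to m - 1 with probability 1 - 3⁻ᵐ and otherwise stays.  Hence, averaged over
-- the rows and over the three choices of t modulo 3, the kept density is
-- (2 + N (1 + h₂ - h₄)) / 3, just above 6/7, where N = ∏ (1 - 3⁻ⁱ) ≈ 0.56013 and hₖ is the complete symmetric
-- function of degree k in 3⁻², 3⁻³, …, so that h₂ → 1/48 and h₄ < 0.00028.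

open import Defs
open import Data.Nat using (ℕ; _*_; _^_; _≤_; _<_)
open import Data.Product using (Σ; _×_)
open import Data.Bool as Bool using (Bool; true; false; if_then_else_; _∧_; _∨_; not; T; T?)
open import Data.Empty using (⊥)
open import Data.Fin using (Fin; zero; suc; #_)
open import Data.Fin.Properties using (_≟_; any?)
open import Data.Fin.Subset using (Subset; ∣_∣)
open import Data.List as List using (List; filterᵇ; length)
import Data.List.Membership.DecPropositional as DecMembership
open import Data.List.Membership.Propositional using (_∈_)
open import Data.List.Relation.Unary.Any using (here; there)
open import Data.Nat as ℕ using (zero; suc; pred; _+_; z≤n; s≤s; _≡ᵇ_; _≤ᵇ_; _≤?_)
open import Data.Nat.Properties hiding (_≟_)
open import Data.Nat.Solver using (module +-*-Solver)
open import Data.Product using (∃; ∃₂; _,_; proj₁; proj₂)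
open import Data.Sum using (_⊎_; inj₁; inj₂)
open import Data.Unit using (⊤; tt)
open import Data.Vec as Vec using (Vec; []; _∷_; _++_; map; lookup; zipWith; replicate; _[_]≔_)
open import Data.Vec.Properties using (lookup-zipWith; lookup-replicate; lookup∘update; lookup∘update′; ≡-dec)
open import Function using (_∘_; id)
open import Relation.Binary.PropositionalEquality
open import Relation.Nullary using (¬_; Dec; yes; no; contradiction; toWitness; map′; _×-dec_; _→-dec_)

open +-*-Solver using (solve; _:+_; _:*_; _:=_; con)

-- The field with three elements and bilinear identities over it

data 𝔽 : Set where
  𝟘 𝟙 𝟚 : 𝔽

infixl 6 _⊕_
infixl 7 _⊗_
infix 4 _==_

_⊕_ : 𝔽 → 𝔽 → 𝔽
𝟘 ⊕ y = y
𝟙 ⊕ 𝟘 = 𝟙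
𝟙 ⊕ 𝟙 = 𝟚
𝟙 ⊕ 𝟚 = 𝟘
𝟚 ⊕ 𝟘 = 𝟚
𝟚 ⊕ 𝟙 = 𝟘
𝟚 ⊕ 𝟚 = 𝟙

⊖_ : 𝔽 → 𝔽
⊖ 𝟘 = 𝟘
⊖ 𝟙 = 𝟚
⊖ 𝟚 = 𝟙

_⊗_ : 𝔽 → 𝔽 → 𝔽
𝟘 ⊗ y = 𝟘
𝟙 ⊗ y = y
𝟚 ⊗ y = ⊖ y

_==_ : 𝔽 → 𝔽 → Bool
𝟘 == 𝟘 = true
𝟙 == 𝟙 = true
𝟚 == 𝟚 = true
_ == _ = false

==-sound : ∀ x y → T (x == y) → x ≡ y
==-sound 𝟘 𝟘 _ = refl
==-sound 𝟙 𝟙 _ = refl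
==-sound 𝟚 𝟚 _ = refl

allV : ∀ k → (Vec 𝔽 k → Bool) → Bool
allV zero P = P []
allV (suc k) P = allV k (λ v → P (𝟘 ∷ v)) ∧ (allV k (λ v → P (𝟙 ∷ v)) ∧ allV k (λ v → P (𝟚 ∷ v)))

T-∧⁻ : ∀ x {y} → T (x ∧ y) → T x × T y
T-∧⁻ true t = tt , t

allV-sound : ∀ k P → T (allV k P) → ∀ v → T (P v)
allV-sound zero P t [] = t
allV-sound (suc k) P t (x ∷ v) with T-∧⁻ (allV k (λ v → P (𝟘 ∷ v))) t
... | t₀ , t₁₂ with T-∧⁻ (allV k (λ v → P (𝟙 ∷ v))) t₁₂
allV-sound (suc k) P t (𝟘 ∷ v) | t₀ , _ | t₁ , t₂ = allV-sound k _ t₀ v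
allV-sound (suc k) P t (𝟙 ∷ v) | t₀ , _ | t₁ , t₂ = allV-sound k _ t₁ v
allV-sound (suc k) P t (𝟚 ∷ v) | t₀ , _ | t₁ , t₂ = allV-sound k _ t₂ v

-- Identities between polynomial functions on 𝔽ᵏ are verified on all 3ᵏ arguments.
brute : ∀ k (f g : Vec 𝔽 k → 𝔽) → T (allV k (λ v → f v == g v)) → ∀ v → f v ≡ g v
brute k f g t v = ==-sound _ _ (allV-sound k _ t v)

lin : ∀ {n} → 𝔽 → Vec 𝔽 n → 𝔽 → Vec 𝔽 n → Vec 𝔽 n
lin α u β v = zipWith (λ a b → α ⊗ a ⊕ β ⊗ b) u v

𝟎 : ∀ {n} → Vec 𝔽 n
𝟎 {n} = replicate n 𝟘

dot : ∀ {n} → Vec 𝔽 n → Vec 𝔽 n → 𝔽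
dot [] [] = 𝟘
dot (a ∷ u) (b ∷ v) = a ⊗ b ⊕ dot u v

⊗-zeroʳ : ∀ x → x ⊗ 𝟘 ≡ 𝟘
⊗-zeroʳ 𝟘 = refl
⊗-zeroʳ 𝟙 = refl
⊗-zeroʳ 𝟚 = refl

⊕-identityʳ : ∀ x → x ⊕ 𝟘 ≡ x
⊕-identityʳ 𝟘 = refl
⊕-identityʳ 𝟙 = refl
⊕-identityʳ 𝟚 = refl

dot-lin : ∀ {n} (w : Vec 𝔽 n) α u β v → dot w (lin α u β v) ≡ α ⊗ dot w u ⊕ β ⊗ dot w v
dot-lin [] α [] β [] = brute 2 (λ _ → 𝟘) (λ { (a ∷ b ∷ []) → a ⊗ 𝟘 ⊕ b ⊗ 𝟘 }) tt (α ∷ β ∷ [])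
dot-lin (c ∷ w) α (a ∷ u) β (b ∷ v) rewrite dot-lin w α u β v =
  brute 7 (λ { (c ∷ α ∷ a ∷ x ∷ β ∷ b ∷ y ∷ []) → c ⊗ (α ⊗ a ⊕ β ⊗ b) ⊕ (α ⊗ x ⊕ β ⊗ y) })
          (λ { (c ∷ α ∷ a ∷ x ∷ β ∷ b ∷ y ∷ []) → α ⊗ (c ⊗ a ⊕ x) ⊕ β ⊗ (c ⊗ b ⊕ y) })
          tt (c ∷ α ∷ a ∷ dot w u ∷ β ∷ b ∷ dot w v ∷ [])

-- Gaussian elimination and nullities

axpy : ∀ {n} → 𝔽 → Vec 𝔽 n → Vec 𝔽 n → Vec 𝔽 n
axpy k w u = zipWith (λ a b → k ⊗ a ⊕ b) w u

-- Eliminates the coordinate of the first nonzero entry of w by subtracting a multiple of w.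
-- For w = 𝟎 the value is junk: the last coordinate is dropped.
elim : ∀ {m} → Vec 𝔽 (suc m) → Vec 𝔽 (suc m) → Vec 𝔽 m
elim (𝟙 ∷ w) (y ∷ u) = axpy (⊖ y) w u
elim (𝟚 ∷ w) (y ∷ u) = axpy y w u
elim {zero} (𝟘 ∷ w) (y ∷ u) = []
elim {suc m} (𝟘 ∷ w) (y ∷ u) = y ∷ elim w u

isZero : ∀ {m} → Vec 𝔽 m → Bool
isZero [] = true
isZero (𝟘 ∷ v) = isZero v
isZero (𝟙 ∷ v) = false
isZero (𝟚 ∷ v) = false

-- Records which rows are independent of the preceding ones.
traj : ∀ {m L} → Vec (Vec 𝔽 m) L → Vec Bool L
traj {m} {zero} [] = []
traj {zero} {suc L} (w ∷ ws) = false ∷ traj ws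
traj {suc m} {suc L} (w ∷ ws) = if isZero w then false ∷ traj ws else true ∷ traj (map (elim w) ws)

-- The nullity after t rows in m columns, read off a trajectory.
nul : ∀ {L} → ℕ → ℕ → Vec Bool L → ℕ
nul zero m bs = m
nul (suc t) m [] = m
nul (suc t) m (false ∷ bs) = nul t m bs
nul (suc t) m (true ∷ bs) = nul t (pred m) bs

-- Sums over all vectors

ΣV : ∀ m → (Vec 𝔽 m → ℕ) → ℕ
ΣV zero g = g []
ΣV (suc m) g = ΣV m (λ v → g (𝟘 ∷ v)) + (ΣV m (λ v → g (𝟙 ∷ v)) + ΣV m (λ v → g (𝟚 ∷ v)))

ΣV-cong : ∀ m {f g : Vec 𝔽 m → ℕ} → (∀ v → f v ≡ g v) → ΣV m f ≡ ΣV m g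
ΣV-cong zero e = e []
ΣV-cong (suc m) e = cong₂ _+_ (ΣV-cong m (e ∘ (𝟘 ∷_))) (cong₂ _+_ (ΣV-cong m (e ∘ (𝟙 ∷_))) (ΣV-cong m (e ∘ (𝟚 ∷_))))

ΣV-+ : ∀ m (f g : Vec 𝔽 m → ℕ) → ΣV m (λ v → f v + g v) ≡ ΣV m f + ΣV m g
ΣV-+ zero f g = refl
ΣV-+ (suc m) f g
  rewrite ΣV-+ m (f ∘ (𝟘 ∷_)) (g ∘ (𝟘 ∷_)) | ΣV-+ m (f ∘ (𝟙 ∷_)) (g ∘ (𝟙 ∷_)) | ΣV-+ m (f ∘ (𝟚 ∷_)) (g ∘ (𝟚 ∷_)) =
  solve 6 (λ a b c d e f → (a :+ b) :+ ((c :+ d) :+ (e :+ f)) := (a :+ (c :+ e)) :+ (b :+ (d :+ f))) refl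
    (ΣV m (f ∘ (𝟘 ∷_))) (ΣV m (g ∘ (𝟘 ∷_))) (ΣV m (f ∘ (𝟙 ∷_))) (ΣV m (g ∘ (𝟙 ∷_))) (ΣV m (f ∘ (𝟚 ∷_))) (ΣV m (g ∘ (𝟚 ∷_)))

ΣV-* : ∀ m c (f : Vec 𝔽 m → ℕ) → ΣV m (λ v → c * f v) ≡ c * ΣV m f
ΣV-* zero c f = refl
ΣV-* (suc m) c f rewrite ΣV-* m c (f ∘ (𝟘 ∷_)) | ΣV-* m c (f ∘ (𝟙 ∷_)) | ΣV-* m c (f ∘ (𝟚 ∷_)) =
  solve 4 (λ c x y z → c :* x :+ (c :* y :+ c :* z) := c :* (x :+ (y :+ z))) refl c
    (ΣV m (f ∘ (𝟘 ∷_))) (ΣV m (f ∘ (𝟙 ∷_))) (ΣV m (f ∘ (𝟚 ∷_)))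

ΣV-const : ∀ m c → ΣV m (λ _ → c) ≡ 3 ^ m * c
ΣV-const zero c = sym (+-identityʳ c)
ΣV-const (suc m) c rewrite ΣV-const m c =
  solve 2 (λ x c → x :* c :+ (x :* c :+ x :* c) := (con 3 :* x) :* c) refl (3 ^ m) c

ΣV-axpy : ∀ m k (w : Vec 𝔽 m) (g : Vec 𝔽 m → ℕ) → ΣV m (g ∘ axpy k w) ≡ ΣV m g
ΣV-axpy zero k [] g = refl
ΣV-axpy (suc m) k (a ∷ w) g
  rewrite ΣV-axpy m k w (g ∘ ((k ⊗ a ⊕ 𝟘) ∷_)) | ΣV-axpy m k w (g ∘ ((k ⊗ a ⊕ 𝟙) ∷_)) | ΣV-axpy m k w (g ∘ ((k ⊗ a ⊕ 𝟚) ∷_))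
  with k ⊗ a
... | 𝟘 = refl
... | 𝟙 = solve 3 (λ x y z → y :+ (z :+ x) := x :+ (y :+ z)) refl (ΣV m (g ∘ (𝟘 ∷_))) (ΣV m (g ∘ (𝟙 ∷_))) (ΣV m (g ∘ (𝟚 ∷_)))
... | 𝟚 = solve 3 (λ x y z → z :+ (x :+ y) := x :+ (y :+ z)) refl (ΣV m (g ∘ (𝟘 ∷_))) (ΣV m (g ∘ (𝟙 ∷_))) (ΣV m (g ∘ (𝟚 ∷_)))

-- The map `elim w` is three-to-one: for each value of the pivot entry, the remaining entries are
-- merely translated. Dropping the last coordinate is three-to-one as well, so `w` may be zero here.
ΣV-elim : ∀ m (w : Vec 𝔽 (suc m)) (g : Vec 𝔽 m → ℕ) → ΣV (suc m) (g ∘ elim w) ≡ 3 * ΣV m g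
ΣV-elim m (𝟙 ∷ w) g
  rewrite ΣV-axpy m 𝟘 w g | ΣV-axpy m 𝟙 w g | ΣV-axpy m 𝟚 w g | +-identityʳ (ΣV m g) = refl
ΣV-elim m (𝟚 ∷ w) g
  rewrite ΣV-axpy m 𝟘 w g | ΣV-axpy m 𝟙 w g | ΣV-axpy m 𝟚 w g | +-identityʳ (ΣV m g) = refl
ΣV-elim zero (𝟘 ∷ []) g rewrite +-identityʳ (g []) = refl
ΣV-elim (suc m) (𝟘 ∷ w) g
  rewrite ΣV-elim m w (g ∘ (𝟘 ∷_)) | ΣV-elim m w (g ∘ (𝟙 ∷_)) | ΣV-elim m w (g ∘ (𝟚 ∷_)) =
  solve 3 (λ x y z → con 3 :* x :+ (con 3 :* y :+ con 3 :* z) := con 3 :* (x :+ (y :+ z))) refl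
    (ΣV m (g ∘ (𝟘 ∷_))) (ΣV m (g ∘ (𝟙 ∷_))) (ΣV m (g ∘ (𝟚 ∷_)))

-- This is 3ᵐ - 1, by a recursion that avoids truncated subtraction.
nonzeros : ℕ → ℕ
nonzeros zero = 0
nonzeros (suc m) = 2 + 3 * nonzeros m

1+nonzeros : ∀ m → suc (nonzeros m) ≡ 3 ^ m
1+nonzeros zero = refl
1+nonzeros (suc m) rewrite sym (1+nonzeros m) =
  solve 1 (λ x → con 3 :+ con 3 :* x := con 3 :* (con 1 :+ x)) refl (nonzeros m)

ΣV-isZero : ∀ m a b → ΣV m (λ w → if isZero w then a else b) ≡ a + nonzeros m * b
ΣV-isZero zero a b = sym (+-identityʳ a)
ΣV-isZero (suc m) a b rewrite ΣV-isZero m a b | ΣV-const m b | sym (1+nonzeros m) =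
  solve 3 (λ a b x → (a :+ x :* b) :+ ((con 1 :+ x) :* b :+ (con 1 :+ x) :* b) := a :+ (con 2 :+ con 3 :* x) :* b) refl a b (nonzeros m)

-- Sums over tuples of rows and the distribution of trajectories

ΣM : ∀ m L → (Vec (Vec 𝔽 m) L → ℕ) → ℕ
ΣM m zero f = f []
ΣM m (suc L) f = ΣV m (λ w → ΣM m L (λ ws → f (w ∷ ws)))

ΣM-cong : ∀ m L {f g : Vec (Vec 𝔽 m) L → ℕ} → (∀ M → f M ≡ g M) → ΣM m L f ≡ ΣM m L g
ΣM-cong m zero e = e []
ΣM-cong m (suc L) e = ΣV-cong m (λ w → ΣM-cong m L (λ ws → e (w ∷ ws)))

ΣM-+ : ∀ m L (f g : Vec (Vec 𝔽 m) L → ℕ) → ΣM m L (λ M → f M + g M) ≡ ΣM m L f + ΣM m L g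
ΣM-+ m zero f g = refl
ΣM-+ m (suc L) f g = trans (ΣV-cong m (λ w → ΣM-+ m L (f ∘ (w ∷_)) (g ∘ (w ∷_))))
  (ΣV-+ m (λ w → ΣM m L (f ∘ (w ∷_))) (λ w → ΣM m L (g ∘ (w ∷_))))

ΣM-* : ∀ m L c (f : Vec (Vec 𝔽 m) L → ℕ) → ΣM m L (λ M → c * f M) ≡ c * ΣM m L f
ΣM-* m zero c f = refl
ΣM-* m (suc L) c f = trans (ΣV-cong m (λ w → ΣM-* m L c (f ∘ (w ∷_)))) (ΣV-* m c (λ w → ΣM m L (f ∘ (w ∷_))))

ΣM-const : ∀ m L c → ΣM m L (λ _ → c) ≡ (3 ^ m) ^ L * c
ΣM-const m zero c = sym (+-identityʳ c)
ΣM-const m (suc L) c = begin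
  ΣV m (λ _ → ΣM m L (λ _ → c))  ≡⟨ ΣV-const m (ΣM m L (λ _ → c)) ⟩
  3 ^ m * ΣM m L (λ _ → c)       ≡⟨ cong (3 ^ m *_) (ΣM-const m L c) ⟩
  3 ^ m * ((3 ^ m) ^ L * c)      ≡⟨ *-assoc (3 ^ m) ((3 ^ m) ^ L) c ⟨
  (3 ^ m) ^ suc L * c            ∎
  where open ≡-Reasoning

ΣM-map : ∀ {m m′} c (φ : Vec 𝔽 m → Vec 𝔽 m′) → (∀ g → ΣV m (g ∘ φ) ≡ c * ΣV m′ g) →
         ∀ L (f : Vec (Vec 𝔽 m′) L → ℕ) → ΣM m L (f ∘ map φ) ≡ c ^ L * ΣM m′ L f
ΣM-map c φ e zero f = sym (+-identityʳ (f []))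
ΣM-map {m} {m′} c φ e (suc L) f = begin
  ΣV m (λ w → ΣM m L (λ ws → f (φ w ∷ map φ ws)))  ≡⟨ ΣV-cong m (λ w → ΣM-map c φ e L (f ∘ (φ w ∷_))) ⟩
  ΣV m (λ w → c ^ L * ΣM m′ L (f ∘ (φ w ∷_)))      ≡⟨ e (λ w → c ^ L * ΣM m′ L (f ∘ (w ∷_))) ⟩
  c * ΣV m′ (λ w → c ^ L * ΣM m′ L (f ∘ (w ∷_)))   ≡⟨ cong (c *_) (ΣV-* m′ (c ^ L) (λ w → ΣM m′ L (f ∘ (w ∷_)))) ⟩
  c * (c ^ L * ΣM m′ (suc L) f)                    ≡⟨ *-assoc c (c ^ L) (ΣM m′ (suc L) f) ⟨
  c ^ suc L * ΣM m′ (suc L) f                      ∎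
  where open ≡-Reasoning

-- The sum of σ over the trajectories of all L-tuples of rows in 𝔽ᵐ, computed without listing these tuples.
Σtraj : ∀ (m L : ℕ) → (Vec Bool L → ℕ) → ℕ
Σtraj m zero σ = σ []
Σtraj zero (suc L) σ = Σtraj zero L (σ ∘ (false ∷_))
Σtraj (suc m) (suc L) σ = Σtraj (suc m) L (σ ∘ (false ∷_)) + nonzeros (suc m) * (3 ^ L * Σtraj m L (σ ∘ (true ∷_)))

-- Once a nonzero first row is eliminated, the later rows are again uniformly distributed, in one
-- column fewer: `ΣM-map` with `ΣV-elim` shows that every reduced tuple arises 3 ^ L times.
ΣM-traj : ∀ m L (σ : Vec Bool L → ℕ) → ΣM m L (σ ∘ traj) ≡ Σtraj m L σ
ΣM-traj m zero σ = refl
ΣM-traj zero (suc L) σ = ΣM-traj zero L (σ ∘ (false ∷_))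
ΣM-traj (suc m) (suc L) σ = trans (ΣV-cong (suc m) step) (ΣV-isZero (suc m) _ _)
  where
  step : ∀ w → ΣM (suc m) L (λ ws → σ (traj (w ∷ ws))) ≡
         (if isZero w then Σtraj (suc m) L (σ ∘ (false ∷_)) else 3 ^ L * Σtraj m L (σ ∘ (true ∷_)))
  step w with isZero w
  ... | true = ΣM-traj (suc m) L (σ ∘ (false ∷_))
  ... | false = trans (ΣM-map 3 (elim w) (ΣV-elim m w) L (σ ∘ (true ∷_) ∘ traj))
                      (cong (3 ^ L *_) (ΣM-traj m L (σ ∘ (true ∷_))))

*-^-distrib : ∀ a b L → (a * b) ^ L ≡ a ^ L * b ^ L
*-^-distrib a b zero = refl
*-^-distrib a b (suc L) rewrite *-^-distrib a b L =
  solve 4 (λ a b x y → (a :* b) :* (x :* y) := (a :* x) :* (b :* y)) refl a b (a ^ L) (b ^ L)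

-- The `L` rows after the first `k` do not influence the summand, so each contributes only the
-- number of its choices, 3 ^ m.
Σtraj-extend : ∀ m k L (σ : Vec Bool (k + L) → ℕ) (σ′ : Vec Bool k → ℕ) → (∀ bs cs → σ (bs ++ cs) ≡ σ′ bs) →
           Σtraj m (k + L) σ ≡ (3 ^ m) ^ L * Σtraj m k σ′
Σtraj-extend m zero L σ σ′ e = begin
  Σtraj m L σ                       ≡⟨ ΣM-traj m L σ ⟨
  ΣM m L (σ ∘ traj)             ≡⟨ ΣM-cong m L (λ M → e [] (traj M)) ⟩
  ΣM m L (λ _ → σ′ [])          ≡⟨ ΣM-const m L (σ′ []) ⟩
  (3 ^ m) ^ L * σ′ []           ∎
  where open ≡-Reasoning
Σtraj-extend zero (suc k) L σ σ′ e = Σtraj-extend zero k L (σ ∘ (false ∷_)) (σ′ ∘ (false ∷_)) (λ bs cs → e (false ∷ bs) cs)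
Σtraj-extend (suc m) (suc k) L σ σ′ e
  rewrite Σtraj-extend (suc m) k L (σ ∘ (false ∷_)) (σ′ ∘ (false ∷_)) (λ bs cs → e (false ∷ bs) cs)
        | Σtraj-extend m k L (σ ∘ (true ∷_)) (σ′ ∘ (true ∷_)) (λ bs cs → e (true ∷ bs) cs)
        | ^-distribˡ-+-* 3 k L | *-^-distrib 3 (3 ^ m) L =
  solve 6 (λ a b x y u v → (a :* b) :* u :+ x :* ((y :* a) :* (b :* v)) := (a :* b) :* (u :+ x :* (y :* v))) refl
    (3 ^ L) ((3 ^ m) ^ L) (nonzeros (suc m)) (3 ^ k) (Σtraj (suc m) k (σ′ ∘ (false ∷_))) (Σtraj m k (σ′ ∘ (true ∷_)))

-- The score of a trajectory and a lower bound for its average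

bit : Bool → ℕ
bit true = 1
bit false = 0

-- Here `m` is the size of the set. In `good` it is the layer t itself; in `bad` it is t - 2, so
-- that t and t + 2 become 2 + `m` and 4 + `m`. Hence 4 + `m` rows determine both.
good bad : ∀ {L} → ℕ → Vec Bool L → Bool
good m bs = if nul m m bs ≡ᵇ 0 then true else ((nul m m bs ≡ᵇ 2) ∧ (nul (2 + m) m bs ≡ᵇ 0))
bad m bs = (nul (2 + m) m bs ≡ᵇ 2) ∧ (nul (4 + m) m bs ≡ᵇ 0)

score : ∀ {L} → ℕ → Vec Bool L → ℕ
score m bs = bit (good m bs) + bit (not (bad m bs))

nul-++ : ∀ {k L} t m (bs : Vec Bool k) (cs : Vec Bool L) → t ≤ k → nul t m (bs ++ cs) ≡ nul t m bs
nul-++ zero m bs cs _ = refl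
nul-++ (suc t) m (false ∷ bs) cs (s≤s le) = nul-++ t m bs cs le
nul-++ (suc t) m (true ∷ bs) cs (s≤s le) = nul-++ t (pred m) bs cs le

score-++ : ∀ {L} m (bs : Vec Bool (4 + m)) (cs : Vec Bool L) → score m (bs ++ cs) ≡ score m bs
score-++ m bs cs
  rewrite nul-++ m m bs cs (m≤n+m m 4) | nul-++ (2 + m) m bs cs (m≤n+m (2 + m) 2) | nul-++ (4 + m) m bs cs ≤-refl = refl

Σtraj-score : ∀ m L → Σtraj m (4 + m + L) (score m) ≡ (3 ^ m) ^ L * Σtraj m (4 + m) (score m)
Σtraj-score m L = Σtraj-extend m (4 + m) L (score m) (score m) (score-++ m)

-- With y = 3ᵐ the core is a/b + 1/(3y) ≤ (1 - 1/(3y)) (a/b + 1/y). Substituting y = 3 + e turns it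
-- into a comparison of coefficients in e: `h₀` amounts to 3a ≤ 5b and `h₁` to a ≤ 2b.
slack-step : ∀ a b y N t C w → 27 * a + 3 * b ≤ 24 * a + 8 * b → 18 * a + b ≤ 17 * a + 3 * b →
         3 ≤ y → suc N ≡ 3 * y → (a * y + b) * C ≤ b * y * w →
         (a * (3 * y) + b) * ((3 * y) * (t * C)) ≤ b * (3 * y) * (N * (t * w))
slack-step a b y N t C w h₀ h₁ 3≤y N+1≡3y ih with m≤n⇒∃[o]m+o≡n 3≤y
... | e , refl = begin
  (a * (3 * y) + b) * ((3 * y) * (t * C))
    ≡⟨ solve 5 (λ a b e t C → (a :* (con 3 :* (con 3 :+ e)) :+ b) :* ((con 3 :* (con 3 :+ e)) :* (t :* C)) :=
                 ((con 27 :* a :+ con 3 :* b) :+ (con 18 :* a :+ b) :* e :+ con 3 :* a :* e :* e) :* (con 3 :* (t :* C))) refl a b e t C ⟩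
  ((27 * a + 3 * b) + (18 * a + b) * e + 3 * a * e * e) * (3 * (t * C))
    ≤⟨ *-monoˡ-≤ (3 * (t * C)) (+-monoˡ-≤ (3 * a * e * e) (+-mono-≤ h₀ (*-monoˡ-≤ e h₁))) ⟩
  ((24 * a + 8 * b) + (17 * a + 3 * b) * e + 3 * a * e * e) * (3 * (t * C))
    ≡⟨ solve 5 (λ a b e t C → ((con 24 :* a :+ con 8 :* b) :+ (con 17 :* a :+ con 3 :* b) :* e :+ con 3 :* a :* e :* e) :* (con 3 :* (t :* C)) :=
                 (con 3 :* (con 8 :+ con 3 :* e) :* t) :* ((a :* (con 3 :+ e) :+ b) :* C)) refl a b e t C ⟩
  (3 * (8 + 3 * e) * t) * ((a * y + b) * C)
    ≡⟨ cong (λ N → (3 * N * t) * ((a * y + b) * C)) (sym N≡) ⟩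
  (3 * N * t) * ((a * y + b) * C)
    ≤⟨ *-monoʳ-≤ (3 * N * t) ih ⟩
  (3 * N * t) * (b * y * w)
    ≡⟨ solve 5 (λ N b y t w → (con 3 :* N :* t) :* (b :* y :* w) := b :* (con 3 :* y) :* (N :* (t :* w))) refl N b y t w ⟩
  b * (3 * y) * (N * (t * w)) ∎
  where
  open ≤-Reasoning
  N≡ : N ≡ 8 + 3 * e
  N≡ = suc-injective (trans N+1≡3y (solve 1 (λ e → con 3 :* (con 3 :+ e) := con 9 :+ con 3 :* e) refl e))

Σtraj-bound-extend : ∀ c d m L → T (c * (3 ^ m) ^ (4 + m) ≤ᵇ d * Σtraj m (4 + m) (score m)) →
                 c * (3 ^ m) ^ (4 + m + L) ≤ d * Σtraj m (4 + m + L) (score m)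
Σtraj-bound-extend c d m L ok = begin
  c * x ^ (4 + m + L)            ≡⟨ cong (c *_) (^-distribˡ-+-* x (4 + m) L) ⟩
  c * (x ^ (4 + m) * x ^ L)      ≡⟨ *-assoc c (x ^ (4 + m)) (x ^ L) ⟨
  c * x ^ (4 + m) * x ^ L        ≤⟨ *-monoˡ-≤ (x ^ L) (≤ᵇ⇒≤ (c * x ^ (4 + m)) (d * w) ok) ⟩
  d * w * x ^ L                  ≡⟨ solve 3 (λ d w x → d :* w :* x := d :* (x :* w)) refl d w (x ^ L) ⟩
  d * (x ^ L * w)                ≡⟨ cong (d *_) (Σtraj-score m L) ⟨
  d * Σtraj m (4 + m + L) (score m)  ∎
  where
  open ≤-Reasoning
  x w : ℕ
  x = 3 ^ m
  w = Σtraj m (4 + m) (score m)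

record Bound (a b m ℓ : ℕ) : Set where
  constructor mk
  field bound : a * (3 ^ m) ^ ℓ ≤ b * Σtraj m ℓ (score m)

-- The bound a / b improved by 3⁻ᵐ, which pays for the factor 1 - 3⁻ᵐ lost when m increases.
record Bound⁺ (a b m ℓ : ℕ) : Set where
  constructor mk
  field bound : (a * 3 ^ m + b) * (3 ^ m) ^ ℓ ≤ b * 3 ^ m * Σtraj m ℓ (score m)

-- An independent first row lowers the nullity, the number of remaining rows and the layer by one
-- together, so `score (suc m)` of `true ∷ bs` is `score m bs` by computation. Trajectories with a
-- zero first row are given away.
Σtraj-suc : ∀ m ℓ → nonzeros (suc m) * (3 ^ ℓ * Σtraj m ℓ (score m)) ≤ Σtraj (suc m) (suc ℓ) (score (suc m))
Σtraj-suc m ℓ = m≤n+m (nonzeros (suc m) * (3 ^ ℓ * Σtraj m ℓ (score m))) (Σtraj (suc m) ℓ (score (suc m) ∘ (false ∷_)))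

Bound⁺-suc : ∀ a b m ℓ → 27 * a + 3 * b ≤ 24 * a + 8 * b → 18 * a + b ≤ 17 * a + 3 * b → 1 ≤ m →
             Bound⁺ a b m ℓ → Bound⁺ a b (suc m) (suc ℓ)
Bound⁺-suc a b m ℓ h₀ h₁ 1≤m (mk ih) = mk (begin
  (a * (3 * 3 ^ m) + b) * (3 * 3 ^ m) ^ suc ℓ
    ≡⟨ cong (λ x → (a * (3 * 3 ^ m) + b) * (3 * 3 ^ m * x)) (*-^-distrib 3 (3 ^ m) ℓ) ⟩
  (a * (3 * 3 ^ m) + b) * (3 * 3 ^ m * (3 ^ ℓ * (3 ^ m) ^ ℓ))
    ≤⟨ slack-step a b (3 ^ m) (nonzeros (suc m)) (3 ^ ℓ) ((3 ^ m) ^ ℓ) (Σtraj m ℓ (score m))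
         h₀ h₁ (^-monoʳ-≤ 3 1≤m) (1+nonzeros (suc m)) ih ⟩
  b * (3 * 3 ^ m) * (nonzeros (suc m) * (3 ^ ℓ * Σtraj m ℓ (score m)))
    ≤⟨ *-monoʳ-≤ (b * (3 * 3 ^ m)) (Σtraj-suc m ℓ) ⟩
  b * (3 * 3 ^ m) * Σtraj (suc m) (suc ℓ) (score (suc m)) ∎)
  where open ≤-Reasoning

Bound-check : ∀ a b m L → T (a * (3 ^ m) ^ (4 + m) ≤ᵇ b * Σtraj m (4 + m) (score m)) → Bound a b m (4 + m + L)
Bound-check a b m L ok = mk (Σtraj-bound-extend a b m L ok)

Bound⁺-check : ∀ a b m L → T ((a * 3 ^ m + b) * (3 ^ m) ^ (4 + m) ≤ᵇ b * 3 ^ m * Σtraj m (4 + m) (score m)) →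
               Bound⁺ a b m (4 + m + L)
Bound⁺-check a b m L ok = mk (Σtraj-bound-extend (a * 3 ^ m + b) (b * 3 ^ m) m L ok)

Bound⁺⇒Bound : ∀ a b m ℓ → Bound⁺ a b m ℓ → Bound a b m ℓ
Bound⁺⇒Bound a b m ℓ (mk h) = mk (*-cancelˡ-≤ (3 ^ m) {{m^n≢0 3 m}} (begin
  y * (a * c)          ≤⟨ m≤m+n (y * (a * c)) (b * c) ⟩
  y * (a * c) + b * c  ≡⟨ solve 4 (λ a b y c → y :* (a :* c) :+ b :* c := (a :* y :+ b) :* c) refl a b y c ⟩
  (a * y + b) * c      ≤⟨ h ⟩
  b * y * w            ≡⟨ solve 3 (λ b y w → b :* y :* w := y :* (b :* w)) refl b y w ⟩
  y * (b * w)          ∎))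
  where
  open ≤-Reasoning
  y c w : ℕ
  y = 3 ^ m
  c = y ^ ℓ
  w = Σtraj m ℓ (score m)

-- At eight columns the exact average leaves room for the extra 3⁻⁸, as evaluation confirms; from
-- there the induction runs. For fewer columns `score-bound` evaluates the plain bound.
Bound⁺-large : ∀ k L → Bound⁺ 3143 2000 (k + 8) (4 + (k + 8) + L)
Bound⁺-large zero L = Bound⁺-check 3143 2000 8 L tt
Bound⁺-large (suc k) L = Bound⁺-suc 3143 2000 (k + 8) (4 + (k + 8) + L) (≤ᵇ⇒≤ _ _ tt) (≤ᵇ⇒≤ _ _ tt)
  (≤-trans (s≤s z≤n) (m≤n+m 8 k)) (Bound⁺-large k L)

score-bound : ∀ m L → Bound 3143 2000 m (4 + m + L)
score-bound 0 L = Bound-check 3143 2000 0 L tt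
score-bound 1 L = Bound-check 3143 2000 1 L tt
score-bound 2 L = Bound-check 3143 2000 2 L tt
score-bound 3 L = Bound-check 3143 2000 3 L tt
score-bound 4 L = Bound-check 3143 2000 4 L tt
score-bound 5 L = Bound-check 3143 2000 5 L tt
score-bound 6 L = Bound-check 3143 2000 6 L tt
score-bound 7 L = Bound-check 3143 2000 7 L tt
score-bound (suc (suc (suc (suc (suc (suc (suc (suc k)))))))) L =
  Bound⁺⇒Bound 3143 2000 (8 + k) (4 + (8 + k) + L) (subst (λ m → Bound⁺ 3143 2000 m (4 + m + L)) (+-comm k 8) (Bound⁺-large k L))

-- Restriction to a set of columns, and sums over the cube

wt co : ∀ {n} → Vec Bool n → ℕ
wt [] = 0
wt (true ∷ X) = suc (wt X)
wt (false ∷ X) = wt X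
co [] = 0
co (true ∷ X) = co X
co (false ∷ X) = suc (co X)

wt+co : ∀ {n} (X : Vec Bool n) → wt X + co X ≡ n
wt+co [] = refl
wt+co (true ∷ X) = cong suc (wt+co X)
wt+co (false ∷ X) = trans (+-suc (wt X) (co X)) (cong suc (wt+co X))

sel : ∀ {n} (X : Vec Bool n) → Vec 𝔽 n → Vec 𝔽 (wt X)
sel [] [] = []
sel (true ∷ X) (a ∷ v) = a ∷ sel X v
sel (false ∷ X) (a ∷ v) = sel X v

ΣV-sel : ∀ {n} (X : Vec Bool n) (g : Vec 𝔽 (wt X) → ℕ) → ΣV n (g ∘ sel X) ≡ 3 ^ co X * ΣV (wt X) g
ΣV-sel [] g = sym (+-identityʳ (g []))
ΣV-sel (true ∷ X) g rewrite ΣV-sel X (g ∘ (𝟘 ∷_)) | ΣV-sel X (g ∘ (𝟙 ∷_)) | ΣV-sel X (g ∘ (𝟚 ∷_)) =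
  solve 4 (λ c x y z → c :* x :+ (c :* y :+ c :* z) := c :* (x :+ (y :+ z))) refl (3 ^ co X)
    (ΣV (wt X) (g ∘ (𝟘 ∷_))) (ΣV (wt X) (g ∘ (𝟙 ∷_))) (ΣV (wt X) (g ∘ (𝟚 ∷_)))
ΣV-sel (false ∷ X) g rewrite ΣV-sel X g =
  solve 2 (λ c x → c :* x :+ (c :* x :+ c :* x) := (con 3 :* c) :* x) refl (3 ^ co X) (ΣV (wt X) g)

ΣB : ∀ n → (Vertex n → ℕ) → ℕ
ΣB zero h = h []
ΣB (suc n) h = ΣB n (h ∘ (false ∷_)) + ΣB n (h ∘ (true ∷_))

ΣB-cong : ∀ n {f g : Vertex n → ℕ} → (∀ X → f X ≡ g X) → ΣB n f ≡ ΣB n g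
ΣB-cong zero e = e []
ΣB-cong (suc n) e = cong₂ _+_ (ΣB-cong n (e ∘ (false ∷_))) (ΣB-cong n (e ∘ (true ∷_)))

ΣB-+ : ∀ n (f g : Vertex n → ℕ) → ΣB n (λ X → f X + g X) ≡ ΣB n f + ΣB n g
ΣB-+ zero f g = refl
ΣB-+ (suc n) f g rewrite ΣB-+ n (f ∘ (false ∷_)) (g ∘ (false ∷_)) | ΣB-+ n (f ∘ (true ∷_)) (g ∘ (true ∷_)) =
  solve 4 (λ a b c d → (a :+ b) :+ (c :+ d) := (a :+ c) :+ (b :+ d)) refl
    (ΣB n (f ∘ (false ∷_))) (ΣB n (g ∘ (false ∷_))) (ΣB n (f ∘ (true ∷_))) (ΣB n (g ∘ (true ∷_)))

ΣB-≥ : ∀ n c {h : Vertex n → ℕ} → (∀ X → c ≤ h X) → 2 ^ n * c ≤ ΣB n h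
ΣB-≥ zero c le = ≤-trans (≤-reflexive (+-identityʳ c)) (le [])
ΣB-≥ (suc n) c le = ≤-trans
  (≤-reflexive (solve 2 (λ x c → (con 2 :* x) :* c := x :* c :+ x :* c) refl (2 ^ n) c))
  (+-mono-≤ (ΣB-≥ n c (le ∘ (false ∷_))) (ΣB-≥ n c (le ∘ (true ∷_))))

ΣM-ΣB : ∀ m L n (h : Vec (Vec 𝔽 m) L → Vertex n → ℕ) →
        ΣM m L (λ M → ΣB n (h M)) ≡ ΣB n (λ X → ΣM m L (λ M → h M X))
ΣM-ΣB m L zero h = refl
ΣM-ΣB m L (suc n) h =
  trans (ΣM-+ m L (λ M → ΣB n (h M ∘ (false ∷_))) (λ M → ΣB n (h M ∘ (true ∷_))))
        (cong₂ _+_ (ΣM-ΣB m L n (λ M → h M ∘ (false ∷_))) (ΣM-ΣB m L n (λ M → h M ∘ (true ∷_))))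

length-filterᵇ-++ : ∀ {A : Set} (p : A → Bool) xs ys →
  length (filterᵇ p (xs List.++ ys)) ≡ length (filterᵇ p xs) + length (filterᵇ p ys)
length-filterᵇ-++ p List.[] ys = refl
length-filterᵇ-++ p (x List.∷ xs) ys with p x
... | true = cong suc (length-filterᵇ-++ p xs ys)
... | false = length-filterᵇ-++ p xs ys

length-filterᵇ-map : ∀ {A B : Set} (p : B → Bool) (f : A → B) xs →
  length (filterᵇ p (List.map f xs)) ≡ length (filterᵇ (p ∘ f) xs)
length-filterᵇ-map p f List.[] = refl
length-filterᵇ-map p f (x List.∷ xs) with p (f x)
... | true = cong suc (length-filterᵇ-map p f xs)
... | false = length-filterᵇ-map p f xs

size-ΣB : ∀ n (S : VSet n) → size S ≡ ΣB n (bit ∘ S)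
size-ΣB zero S with S []
... | true = refl
... | false = refl
size-ΣB (suc n) S = begin
  size S
    ≡⟨ length-filterᵇ-++ S (List.map (false ∷_) (allVertices n)) (List.map (true ∷_) (allVertices n)) ⟩
  length (filterᵇ S (List.map (false ∷_) (allVertices n))) + length (filterᵇ S (List.map (true ∷_) (allVertices n)))
    ≡⟨ cong₂ _+_ (length-filterᵇ-map S (false ∷_) (allVertices n)) (length-filterᵇ-map S (true ∷_) (allVertices n)) ⟩
  size (S ∘ (false ∷_)) + size (S ∘ (true ∷_))
    ≡⟨ cong₂ _+_ (size-ΣB n (S ∘ (false ∷_))) (size-ΣB n (S ∘ (true ∷_))) ⟩
  ΣB (suc n) (bit ∘ S) ∎
  where open ≡-Reasoning

-- Choosing a summand that reaches the average

one-of-three : ∀ a {x y z} → 3 * a ≤ x + (y + z) → a ≤ x ⊎ a ≤ y ⊎ a ≤ z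
one-of-three a {x} {y} {z} le with a ≤? x | a ≤? y | a ≤? z
... | yes p | _ | _ = inj₁ p
... | no _ | yes p | _ = inj₂ (inj₁ p)
... | no _ | no _ | yes p = inj₂ (inj₂ p)
... | no p | no q | no r = contradiction (+-mono-< (≰⇒> p) (+-mono-< (≰⇒> q) (≰⇒> r))) (≤⇒≯ (subst (_≤ x + (y + z)) (cong (a +_) (cong (a +_) (+-identityʳ a))) le))

ΣV-max : ∀ m c (g : Vec 𝔽 m → ℕ) → 3 ^ m * c ≤ ΣV m g → ∃ λ v → c ≤ g v
ΣV-max zero c g le = [] , subst (_≤ g []) (+-identityʳ c) le
ΣV-max (suc m) c g le with one-of-three (3 ^ m * c) (subst (_≤ ΣV (suc m) g) (*-assoc 3 (3 ^ m) c) le)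
... | inj₁ le₀ = let v , p = ΣV-max m c (g ∘ (𝟘 ∷_)) le₀ in 𝟘 ∷ v , p
... | inj₂ (inj₁ le₁) = let v , p = ΣV-max m c (g ∘ (𝟙 ∷_)) le₁ in 𝟙 ∷ v , p
... | inj₂ (inj₂ le₂) = let v , p = ΣV-max m c (g ∘ (𝟚 ∷_)) le₂ in 𝟚 ∷ v , p

ΣM-max : ∀ m L c (f : Vec (Vec 𝔽 m) L → ℕ) → (3 ^ m) ^ L * c ≤ ΣM m L f → ∃ λ M → c ≤ f M
ΣM-max m zero c f le = [] , subst (_≤ f []) (+-identityʳ c) le
ΣM-max m (suc L) c f le with ΣV-max m ((3 ^ m) ^ L * c) _ (subst (_≤ ΣM m (suc L) f) (*-assoc (3 ^ m) ((3 ^ m) ^ L) c) le)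
... | w , p = let M , q = ΣM-max m L c (f ∘ (w ∷_)) p in w ∷ M , q

-- The families and their density

-- The residues modulo 3 of |X| - t: for 0 the nullities decide, for 1 the sets of size t′ - 2 with t′ = t + 3 are
-- filtered, and for 2 all sets are kept.
data Phase : Set where
  main guard free : Phase

next : Phase → Phase
next main = guard
next guard = free
next free = main

phase : Phase → ℕ → Phase
phase o zero = o
phase o (suc k) = next (phase o k)

-- The map `next` permutes the phases cyclically, so a shift by `k` only reorders the three terms.
phase-sum : ∀ (f : Phase → ℕ) k → f (phase main k) + (f (phase guard k) + f (phase free k)) ≡ f main + (f guard + f free)
phase-sum f zero = refl
phase-sum f (suc k) = trans (phase-sum (f ∘ next) k)
  (solve 3 (λ a b c → b :+ (c :+ a) := a :+ (b :+ c)) refl (f main) (f guard) (f free))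

accept : ∀ {L} → ℕ → Vec Bool L → Phase → Bool
accept k bs main = good k bs
accept k bs guard = not (bad k bs)
accept k bs free = true

profile : ∀ {n L} → Vec (Vec 𝔽 n) L → Vertex n → Vec Bool L
profile M X = traj (map (sel X) M)

family : ∀ {n L} → Vec (Vec 𝔽 n) L → Phase → VSet n
family M o X = accept (wt X) (profile M X) (phase o (wt X))

weight : ∀ {n L} → Vec (Vec 𝔽 n) L → Vertex n → ℕ
weight M X = score (wt X) (profile M X)

family-size : ∀ {n L} (M : Vec (Vec 𝔽 n) L) →
  size (family M main) + (size (family M guard) + size (family M free)) ≡ ΣB n (λ X → weight M X + 1)
family-size {n} M = begin
  size (family M main) + (size (family M guard) + size (family M free))
    ≡⟨ cong₂ _+_ (size-ΣB n (family M main)) (cong₂ _+_ (size-ΣB n (family M guard)) (size-ΣB n (family M free))) ⟩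
  ΣB n (f main) + (ΣB n (f guard) + ΣB n (f free))
    ≡⟨ cong (ΣB n (f main) +_) (ΣB-+ n (f guard) (f free)) ⟨
  ΣB n (f main) + ΣB n (λ X → f guard X + f free X)
    ≡⟨ ΣB-+ n (f main) (λ X → f guard X + f free X) ⟨
  ΣB n (λ X → f main X + (f guard X + f free X))
    -- The phases `main` and `guard` give the two terms of `score`; `free` accepts every set and
    -- gives the 1.
    ≡⟨ ΣB-cong n (λ X → trans (phase-sum (bit ∘ accept (wt X) (profile M X)) (wt X))
         (sym (+-assoc (bit (good (wt X) (profile M X))) _ 1))) ⟩
  ΣB n (λ X → weight M X + 1) ∎
  where
  open ≡-Reasoning
  f : Phase → Vertex n → ℕ
  f o = bit ∘ family M o

^-split : ∀ {n} (X : Vec Bool n) L → (3 ^ n) ^ L ≡ (3 ^ co X) ^ L * (3 ^ wt X) ^ L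
^-split {n} X L = begin
  (3 ^ n) ^ L                      ≡⟨ cong (λ n → (3 ^ n) ^ L) (wt+co X) ⟨
  (3 ^ (wt X + co X)) ^ L          ≡⟨ cong (_^ L) (^-distribˡ-+-* 3 (wt X) (co X)) ⟩
  (3 ^ wt X * 3 ^ co X) ^ L        ≡⟨ *-^-distrib (3 ^ wt X) (3 ^ co X) L ⟩
  (3 ^ wt X) ^ L * (3 ^ co X) ^ L  ≡⟨ *-comm ((3 ^ wt X) ^ L) ((3 ^ co X) ^ L) ⟩
  (3 ^ co X) ^ L * (3 ^ wt X) ^ L  ∎
  where open ≡-Reasoning

-- Restricting the rows to `X` produces every tuple of rows in `wt X` columns equally often, namely
-- (3 ^ co X) ^ L times, so the average over `M` is the one bounded by `Bound`.
weight-average : ∀ {a b n L} (X : Vertex n) → Bound a b (wt X) L →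
  a * (3 ^ n) ^ L ≤ b * ΣM n L (λ M → weight M X)
weight-average {a} {b} {n} {L} X (mk le) = begin
  a * (3 ^ n) ^ L
    ≡⟨ cong (a *_) (^-split X L) ⟩
  a * (c * (3 ^ k) ^ L)
    ≡⟨ solve 3 (λ a c x → a :* (c :* x) := c :* (a :* x)) refl a c ((3 ^ k) ^ L) ⟩
  c * (a * (3 ^ k) ^ L)
    ≤⟨ *-monoʳ-≤ c le ⟩
  c * (b * Σtraj k L (score k))
    ≡⟨ solve 3 (λ a c x → c :* (a :* x) := a :* (c :* x)) refl b c (Σtraj k L (score k)) ⟩
  b * (c * Σtraj k L (score k))
    ≡⟨ cong (λ x → b * (c * x)) (ΣM-traj k L (score k)) ⟨
  b * (c * ΣM k L (score k ∘ traj))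
    ≡⟨ cong (b *_) (ΣM-map (3 ^ co X) (sel X) (ΣV-sel X) L (score k ∘ traj)) ⟨
  b * ΣM n L (λ M → weight M X) ∎
  where
  open ≤-Reasoning
  k c : ℕ
  k = wt X
  c = (3 ^ co X) ^ L

total-average : ∀ {a b} n L → (∀ X → Bound a b (wt {n} X) L) →
  (3 ^ n) ^ L * (2 ^ n * (a + b)) ≤ ΣM n L (λ M → ΣB n (λ X → b * (weight M X + 1)))
total-average {a} {b} n L B = begin
  Q * (2 ^ n * (a + b))
    ≡⟨ solve 3 (λ q x a → q :* (x :* a) := x :* (a :* q)) refl Q (2 ^ n) (a + b) ⟩
  2 ^ n * ((a + b) * Q)
    ≤⟨ ΣB-≥ n ((a + b) * Q) each ⟩
  ΣB n (λ X → ΣM n L (λ M → b * (weight M X + 1)))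
    ≡⟨ ΣM-ΣB n L n (λ M X → b * (weight M X + 1)) ⟨
  ΣM n L (λ M → ΣB n (λ X → b * (weight M X + 1))) ∎
  where
  open ≤-Reasoning
  Q : ℕ
  Q = (3 ^ n) ^ L
  each : ∀ X → (a + b) * Q ≤ ΣM n L (λ M → b * (weight M X + 1))
  each X = begin
    (a + b) * Q                                            ≡⟨ *-distribʳ-+ Q a b ⟩
    a * Q + b * Q                                 ≤⟨ +-monoˡ-≤ (b * Q) (weight-average X (B X)) ⟩
    b * ΣM n L (λ M → weight M X) + b * Q         ≡⟨ *-distribˡ-+ b (ΣM n L (λ M → weight M X)) Q ⟨
    b * (ΣM n L (λ M → weight M X) + Q)              ≡⟨ cong (λ x → b * (ΣM n L (λ M → weight M X) + x)) (trans (ΣM-const n L 1) (*-identityʳ Q)) ⟨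
    b * (ΣM n L (λ M → weight M X) + ΣM n L (λ _ → 1)) ≡⟨ cong (b *_) (ΣM-+ n L (λ M → weight M X) (λ _ → 1)) ⟨
    b * ΣM n L (λ M → weight M X + 1)                ≡⟨ ΣM-* n L b (λ M → weight M X + 1) ⟨
    ΣM n L (λ M → b * (weight M X + 1))              ∎

ΣB-* : ∀ n c (f : Vertex n → ℕ) → ΣB n (λ X → c * f X) ≡ c * ΣB n f
ΣB-* zero c f = refl
ΣB-* (suc n) c f = trans (cong₂ _+_ (ΣB-* n c (f ∘ (false ∷_))) (ΣB-* n c (f ∘ (true ∷_))))
  (sym (*-distribˡ-+ c (ΣB n (f ∘ (false ∷_))) (ΣB n (f ∘ (true ∷_)))))

-- The average is used twice: some `M` reaches the mean of the total size over the three offsets,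
-- and then one offset carries at least a third of that total.
dense-family : ∀ {a b} n L → (∀ X → Bound a b (wt {n} X) L) →
  ∃ λ (M : Vec (Vec 𝔽 n) L) → ∃ λ o → (a + b) * 2 ^ n ≤ 3 * b * size (family M o)
dense-family {a} {b} n L B with ΣM-max n L (2 ^ n * (a + b)) (λ M → ΣB n (λ X → b * (weight M X + 1))) (total-average n L B)
... | M , le with one-of-three ((a + b) * 2 ^ n) (begin
    3 * ((a + b) * 2 ^ n)
      ≡⟨ cong (3 *_) (*-comm (a + b) (2 ^ n)) ⟩
    3 * (2 ^ n * (a + b))
      ≤⟨ *-monoʳ-≤ 3 le ⟩
    3 * ΣB n (λ X → b * (weight M X + 1))
      ≡⟨ cong (3 *_) (trans (ΣB-* n b (λ X → weight M X + 1)) (cong (b *_) (sym (family-size M)))) ⟩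
    3 * (b * (size (family M main) + (size (family M guard) + size (family M free))))
      ≡⟨ solve 4 (λ c x y z → con 3 :* (c :* (x :+ (y :+ z))) := con 3 :* c :* x :+ (con 3 :* c :* y :+ con 3 :* c :* z)) refl
           b (size (family M main)) (size (family M guard)) (size (family M free)) ⟩
    3 * b * size (family M main) + (3 * b * size (family M guard) + 3 * b * size (family M free)) ∎)
  where open ≤-Reasoning
... | inj₁ p = M , main , p
... | inj₂ (inj₁ p) = M , guard , p
... | inj₂ (inj₂ p) = M , free , p

-- Kernels and their dimensions

lookup-lin : ∀ {n} i α (u : Vec 𝔽 n) β v → lookup (lin α u β v) i ≡ α ⊗ lookup u i ⊕ β ⊗ lookup v i
lookup-lin i α u β v = lookup-zipWith (λ a b → α ⊗ a ⊕ β ⊗ b) i u v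

dot-isZero : ∀ {n} (w : Vec 𝔽 n) → isZero w ≡ true → ∀ c → dot w c ≡ 𝟘
dot-isZero [] _ [] = refl
dot-isZero (𝟘 ∷ w) e (_ ∷ c) = dot-isZero w e c

lin-𝟘-𝟘 : ∀ {n} (u v : Vec 𝔽 n) → lin 𝟘 u 𝟘 v ≡ 𝟎
lin-𝟘-𝟘 [] [] = refl
lin-𝟘-𝟘 (_ ∷ u) (_ ∷ v) = cong (𝟘 ∷_) (lin-𝟘-𝟘 u v)

lin-𝟘-𝟙 : ∀ {n} (u v : Vec 𝔽 n) → lin 𝟘 u 𝟙 v ≡ v
lin-𝟘-𝟙 [] [] = refl
lin-𝟘-𝟙 (_ ∷ u) (b ∷ v) = cong (b ∷_) (lin-𝟘-𝟙 u v)

dot-axpy : ∀ {n} k (w u c : Vec 𝔽 n) → dot (axpy k w u) c ≡ k ⊗ dot w c ⊕ dot u c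
dot-axpy k [] [] [] = sym (trans (⊕-identityʳ _) (⊗-zeroʳ k))
dot-axpy k (a ∷ w) (b ∷ u) (c ∷ cs) rewrite dot-axpy k w u cs =
  brute 6 (λ { (k ∷ a ∷ b ∷ c ∷ x ∷ y ∷ []) → (k ⊗ a ⊕ b) ⊗ c ⊕ (k ⊗ x ⊕ y) })
          (λ { (k ∷ a ∷ b ∷ c ∷ x ∷ y ∷ []) → k ⊗ (a ⊗ c ⊕ x) ⊕ (b ⊗ c ⊕ y) })
          tt (k ∷ a ∷ b ∷ c ∷ dot w cs ∷ dot u cs ∷ [])

-- The transpose of elim w, with image the kernel of w.
back : ∀ {m} → Vec 𝔽 (suc m) → Vec 𝔽 m → Vec 𝔽 (suc m)
back (𝟙 ∷ w) c = ⊖ dot w c ∷ c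
back (𝟚 ∷ w) c = dot w c ∷ c
back {zero} (𝟘 ∷ w) c = 𝟘 ∷ c
back {suc m} (𝟘 ∷ w) (y ∷ c) = y ∷ back w c

dot-back : ∀ {m} (w u : Vec 𝔽 (suc m)) c → dot u (back w c) ≡ dot (elim w u) c
dot-back (𝟙 ∷ w) (y ∷ u) c rewrite dot-axpy (⊖ y) w u c =
  brute 3 (λ { (y ∷ a ∷ b ∷ []) → y ⊗ (⊖ a) ⊕ b }) (λ { (y ∷ a ∷ b ∷ []) → (⊖ y) ⊗ a ⊕ b }) tt (y ∷ dot w c ∷ dot u c ∷ [])
dot-back (𝟚 ∷ w) (y ∷ u) c = sym (dot-axpy y w u c)
dot-back {zero} (𝟘 ∷ w) (y ∷ []) [] rewrite ⊗-zeroʳ y = refl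
dot-back {suc m} (𝟘 ∷ w) (y ∷ u) (x ∷ c) = cong (y ⊗ x ⊕_) (dot-back w u c)

dot-back-self : ∀ {m} (w : Vec 𝔽 (suc m)) → isZero w ≡ false → ∀ c → dot w (back w c) ≡ 𝟘
dot-back-self (𝟙 ∷ w) _ c = brute 1 (λ { (a ∷ []) → ⊖ a ⊕ a }) (λ _ → 𝟘) tt (dot w c ∷ [])
dot-back-self (𝟚 ∷ w) _ c = brute 1 (λ { (a ∷ []) → ⊖ a ⊕ a }) (λ _ → 𝟘) tt (dot w c ∷ [])
dot-back-self {zero} (𝟘 ∷ []) ()
dot-back-self {suc m} (𝟘 ∷ w) e (y ∷ c) = dot-back-self w e c

solve-head : ∀ x y → x ⊕ y ≡ 𝟘 → ⊖ y ≡ x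
solve-head 𝟘 𝟘 _ = refl
solve-head 𝟙 𝟚 _ = refl
solve-head 𝟚 𝟙 _ = refl

back-surjective : ∀ {m} (w : Vec 𝔽 (suc m)) → isZero w ≡ false → ∀ c → dot w c ≡ 𝟘 → ∃ λ d → back w d ≡ c
back-surjective (𝟙 ∷ w) _ (x ∷ c) e = c , cong (_∷ c) (solve-head x (dot w c) e)
back-surjective (𝟚 ∷ w) _ (x ∷ c) e = c , cong (_∷ c) (trans (sym (⊖⊖ (dot w c))) (trans (cong ⊖_ (solve-head (⊖ x) (dot w c) e)) (⊖⊖ x)))
  where
  ⊖⊖ : ∀ x → ⊖ (⊖ x) ≡ x
  ⊖⊖ x = brute 1 (λ { (a ∷ []) → ⊖ (⊖ a) }) (λ { (a ∷ []) → a }) tt (x ∷ [])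
back-surjective {zero} (𝟘 ∷ []) ()
back-surjective {suc m} (𝟘 ∷ w) e (x ∷ c) h = let d , p = back-surjective w e c h in x ∷ d , cong (x ∷_) p

back-lin : ∀ {m} (w : Vec 𝔽 (suc m)) α u β v → back w (lin α u β v) ≡ lin α (back w u) β (back w v)
back-lin (𝟙 ∷ w) α u β v rewrite dot-lin w α u β v = cong (_∷ lin α u β v)
  (brute 4 (λ { (α ∷ a ∷ β ∷ b ∷ []) → ⊖ (α ⊗ a ⊕ β ⊗ b) }) (λ { (α ∷ a ∷ β ∷ b ∷ []) → α ⊗ (⊖ a) ⊕ β ⊗ (⊖ b) })
    tt (α ∷ dot w u ∷ β ∷ dot w v ∷ []))
back-lin (𝟚 ∷ w) α u β v = cong (_∷ lin α u β v) (dot-lin w α u β v)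
back-lin {zero} (𝟘 ∷ w) α [] β [] rewrite ⊗-zeroʳ α | ⊗-zeroʳ β = refl
back-lin {suc m} (𝟘 ∷ w) α (a ∷ u) β (b ∷ v) = cong (α ⊗ a ⊕ β ⊗ b ∷_) (back-lin w α u β v)

∷-injective : ∀ {n} {x y : 𝔽} {u v : Vec 𝔽 n} → x ∷ u ≡ y ∷ v → x ≡ y × u ≡ v
∷-injective refl = refl , refl

back-injective : ∀ {m} (w : Vec 𝔽 (suc m)) c → back w c ≡ 𝟎 → c ≡ 𝟎
back-injective (𝟙 ∷ w) c e = proj₂ (∷-injective e)
back-injective (𝟚 ∷ w) c e = proj₂ (∷-injective e)
back-injective {zero} (𝟘 ∷ w) [] e = refl
back-injective {suc m} (𝟘 ∷ w) (y ∷ c) e with ∷-injective e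
... | refl , e′ = cong (𝟘 ∷_) (back-injective w c e′)

-- When the rows run out there are no further conditions, in agreement with `nul` on an empty
-- trajectory.
Ker : ∀ {m L} → ℕ → Vec (Vec 𝔽 m) L → Vec 𝔽 m → Set
Ker zero M c = ⊤
Ker (suc t) [] c = ⊤
Ker (suc t) (w ∷ M) c = dot w c ≡ 𝟘 × Ker t M c

Ker-lin : ∀ {m L} t (M : Vec (Vec 𝔽 m) L) α u β v → Ker t M u → Ker t M v → Ker t M (lin α u β v)
Ker-lin zero M α u β v _ _ = tt
Ker-lin (suc t) [] α u β v _ _ = tt
Ker-lin (suc t) (w ∷ M) α u β v (p , p′) (q , q′) =
  trans (dot-lin w α u β v) (trans (cong₂ (λ x y → α ⊗ x ⊕ β ⊗ y) p q) (trans (cong (_⊕ β ⊗ 𝟘) (⊗-zeroʳ α)) (⊗-zeroʳ β))) ,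
  Ker-lin t M α u β v p′ q′

-- The vector `w` is the row following the first `t`, or 𝟎 if there is none. It lets passing to one
-- more row be treated as a single linear equation.
Ker-suc : ∀ {m L} t (M : Vec (Vec 𝔽 m) L) → ∃ λ w → ∀ c → Ker t M c → dot w c ≡ 𝟘 → Ker (suc t) M c
Ker-suc zero [] = 𝟎 , λ c _ _ → tt
Ker-suc zero (w ∷ M) = w , λ c _ e → e , tt
Ker-suc (suc t) [] = 𝟎 , λ c _ _ → tt
Ker-suc (suc t) (w ∷ M) = let w′ , f = Ker-suc t M in w′ , λ c (p , q) e → p , f c q e

Ker-elim : ∀ {m L} t (w : Vec 𝔽 (suc m)) (M : Vec (Vec 𝔽 (suc m)) L) c → Ker t (map (elim w) M) c → Ker t M (back w c)
Ker-elim zero w M c _ = tt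
Ker-elim (suc t) w [] c _ = tt
Ker-elim (suc t) w (u ∷ M) c (p , q) = trans (dot-back w u c) p , Ker-elim t w M c q

Ker-elim⁻ : ∀ {m L} t (w : Vec 𝔽 (suc m)) (M : Vec (Vec 𝔽 (suc m)) L) c → Ker t M (back w c) → Ker t (map (elim w) M) c
Ker-elim⁻ zero w M c _ = tt
Ker-elim⁻ (suc t) w [] c _ = tt
Ker-elim⁻ (suc t) w (u ∷ M) c (p , q) = trans (sym (dot-back w u c)) p , Ker-elim⁻ t w M c q

-- That `K` has dimension `k` is encoded as a linear isomorphism from 𝔽ᵏ onto `K`; arguments in
-- dimensions 0, 1 and 2 then become case analysis on coordinate vectors.
record Basis {n} (k : ℕ) (K : Vec 𝔽 n → Set) : Set where
  field
    φ : Vec 𝔽 k → Vec 𝔽 n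
    φ-lin : ∀ α u β v → φ (lin α u β v) ≡ lin α (φ u) β (φ v)
    φ-injective : ∀ u → φ u ≡ 𝟎 → u ≡ 𝟎
    φ-∈ : ∀ u → K (φ u)
    φ-surjective : ∀ c → K c → ∃ λ u → φ u ≡ c

  φ-𝟎 : φ 𝟎 ≡ 𝟎
  φ-𝟎 = trans (cong φ (sym (lin-𝟘-𝟘 𝟎 𝟎))) (trans (φ-lin 𝟘 𝟎 𝟘 𝟎) (lin-𝟘-𝟘 (φ 𝟎) (φ 𝟎)))

full : ∀ {m} {K : Vec 𝔽 m → Set} → (∀ c → K c) → Basis m K
full all = record
  { φ = id ; φ-lin = λ _ _ _ _ → refl ; φ-injective = λ _ e → e ; φ-∈ = all ; φ-surjective = λ c _ → c , refl }

Basis-resp : ∀ {n k} {K K′ : Vec 𝔽 n → Set} → (∀ c → K c → K′ c) → (∀ c → K′ c → K c) → Basis k K → Basis k K′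
Basis-resp to from B = record
  { φ = φ ; φ-lin = φ-lin ; φ-injective = φ-injective
  ; φ-∈ = λ u → to _ (φ-∈ u) ; φ-surjective = λ c p → φ-surjective c (from c p) }
  where open Basis B

-- This ties the counting to linear algebra. A row that has become zero imposes no condition. For
-- any other `w`, the kernel of `w` is the image of `back w`, and pulling the later rows back along
-- it gives the rows reduced by `elim w`.
Ker-basis : ∀ {m L} t (M : Vec (Vec 𝔽 m) L) → Basis (nul t m (traj M)) (Ker t M)
Ker-basis zero M = full (λ _ → tt)
Ker-basis (suc t) [] = full (λ _ → tt)
Ker-basis {zero} (suc t) (w ∷ M) = Basis-resp (λ { [] p → dot-isZero w (empty w) [] , p }) (λ _ → proj₂) (Ker-basis t M)
  where
  empty : (w : Vec 𝔽 0) → isZero w ≡ true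
  empty [] = refl
Ker-basis {suc m} (suc t) (w ∷ M) with isZero w in eq
... | true = Basis-resp (λ c p → dot-isZero w eq c , p) (λ _ → proj₂) (Ker-basis t M)
... | false = record
  { φ = back w ∘ φ
  ; φ-lin = λ α u β v → trans (cong (back w) (φ-lin α u β v)) (back-lin w α (φ u) β (φ v))
  ; φ-injective = λ u e → φ-injective u (back-injective w (φ u) e)
  ; φ-∈ = λ u → dot-back-self w eq (φ u) , Ker-elim t w M (φ u) (φ-∈ u)
  ; φ-surjective = λ c (p , q) → sur c (back-surjective w eq c p) q }
  where
  open Basis (Ker-basis t (map (elim w) M))
  sur : ∀ c → (∃ λ d → back w d ≡ c) → Ker t M c → ∃ λ u → back w (φ u) ≡ c
  sur c (d , refl) q = let u , e = φ-surjective d (Ker-elim⁻ t w M d q) in u , cong (back w) e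

-- Kernel vectors supported on a set of columns

Supp : ∀ {n} → Vec 𝔽 n → Vec Bool n → Set
Supp c X = ∀ i → lookup X i ≡ false → lookup c i ≡ 𝟘

ext : ∀ {n} (X : Vec Bool n) → Vec 𝔽 (wt X) → Vec 𝔽 n
ext [] [] = []
ext (true ∷ X) (a ∷ c) = a ∷ ext X c
ext (false ∷ X) c = 𝟘 ∷ ext X c

dot-ext : ∀ {n} (X : Vec Bool n) u c → dot u (ext X c) ≡ dot (sel X u) c
dot-ext [] [] [] = refl
dot-ext (true ∷ X) (a ∷ u) (b ∷ c) = cong (a ⊗ b ⊕_) (dot-ext X u c)
dot-ext (false ∷ X) (a ∷ u) c rewrite ⊗-zeroʳ a = dot-ext X u c

ext-lin : ∀ {n} (X : Vec Bool n) α u β v → ext X (lin α u β v) ≡ lin α (ext X u) β (ext X v)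
ext-lin [] α [] β [] = refl
ext-lin (true ∷ X) α (a ∷ u) β (b ∷ v) = cong (α ⊗ a ⊕ β ⊗ b ∷_) (ext-lin X α u β v)
ext-lin (false ∷ X) α u β v =
  cong₂ _∷_ (sym (trans (cong (_⊕ β ⊗ 𝟘) (⊗-zeroʳ α)) (⊗-zeroʳ β))) (ext-lin X α u β v)

ext-injective : ∀ {n} (X : Vec Bool n) c → ext X c ≡ 𝟎 → c ≡ 𝟎
ext-injective [] [] _ = refl
ext-injective (true ∷ X) (a ∷ c) e with ∷-injective e
... | refl , e′ = cong (𝟘 ∷_) (ext-injective X c e′)
ext-injective (false ∷ X) c e = ext-injective X c (proj₂ (∷-injective e))

Supp-ext : ∀ {n} (X : Vec Bool n) c → Supp (ext X c) X
Supp-ext (true ∷ X) (a ∷ c) (suc i) e = Supp-ext X c i e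
Supp-ext (false ∷ X) c zero _ = refl
Supp-ext (false ∷ X) c (suc i) e = Supp-ext X c i e

ext-sel : ∀ {n} (X : Vec Bool n) c → Supp c X → ext X (sel X c) ≡ c
ext-sel [] [] _ = refl
ext-sel (true ∷ X) (a ∷ c) s = cong (a ∷_) (ext-sel X c (s ∘ suc))
ext-sel (false ∷ X) (a ∷ c) s = cong₂ _∷_ (sym (s zero refl)) (ext-sel X c (s ∘ suc))

Ker-ext : ∀ {n L} t (M : Vec (Vec 𝔽 n) L) X c → Ker t (map (sel X) M) c → Ker t M (ext X c)
Ker-ext zero M X c _ = tt
Ker-ext (suc t) [] X c _ = tt
Ker-ext (suc t) (w ∷ M) X c (p , q) = trans (dot-ext X w c) p , Ker-ext t M X c q

Ker-ext⁻ : ∀ {n L} t (M : Vec (Vec 𝔽 n) L) X c → Ker t M (ext X c) → Ker t (map (sel X) M) c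
Ker-ext⁻ zero M X c _ = tt
Ker-ext⁻ (suc t) [] X c _ = tt
Ker-ext⁻ (suc t) (w ∷ M) X c (p , q) = trans (sym (dot-ext X w c)) p , Ker-ext⁻ t M X c q

ν : ∀ {n L} → ℕ → Vec (Vec 𝔽 n) L → Vertex n → ℕ
ν t M X = nul t (wt X) (profile M X)

-- Padding with zeros by `ext X` identifies the kernel of the restricted rows with the kernel
-- vectors supported on `X`.
Ker-basis-on : ∀ {n L} t (M : Vec (Vec 𝔽 n) L) X → Basis (ν t M X) (λ c → Ker t M c × Supp c X)
Ker-basis-on t M X = record
  { φ = ext X ∘ φ
  ; φ-lin = λ α u β v → trans (cong (ext X) (φ-lin α u β v)) (ext-lin X α (φ u) β (φ v))
  ; φ-injective = λ u e → φ-injective u (ext-injective X (φ u) e)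
  ; φ-∈ = λ u → Ker-ext t M X (φ u) (φ-∈ u) , Supp-ext X (φ u)
  ; φ-surjective = λ c (p , s) →
      let u , e = φ-surjective (sel X c) (Ker-ext⁻ t M X (sel X c) (subst (Ker t M) (sym (ext-sel X c s)) p))
      in u , trans (cong (ext X) e) (ext-sel X c s) }
  where open Basis (Ker-basis t (map (sel X) M))

-- Independent pairs and small systems of equations

Indep : ∀ {n} → Vec 𝔽 n → Vec 𝔽 n → Set
Indep u v = ∀ α β → lin α u β v ≡ 𝟎 → α ≡ 𝟘 × β ≡ 𝟘

Pair : ∀ {n} → (Vec 𝔽 n → Set) → Set
Pair K = ∃₂ λ u v → K u × K v × Indep u v

trivial : ∀ {n} {K : Vec 𝔽 n → Set} → Basis 0 K → ∀ c → K c → c ≡ 𝟎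
trivial B c p with Basis.φ-surjective B c p
... | [] , refl = Basis.φ-𝟎 B

nontrivial : ∀ {n k} {K : Vec 𝔽 n → Set} → Basis (suc k) K → ∃ λ c → K c × c ≢ 𝟎
nontrivial B = φ (𝟙 ∷ 𝟎) , φ-∈ _ , λ e → contradiction (φ-injective _ e) λ ()
  where open Basis B

pair : ∀ {n} {K : Vec 𝔽 n → Set} → Basis 2 K → Pair K
pair B = φ (𝟙 ∷ 𝟘 ∷ []) , φ (𝟘 ∷ 𝟙 ∷ []) , φ-∈ _ , φ-∈ _ , indep
  where
  open Basis B
  coefficients : ∀ α β → lin α (𝟙 ∷ 𝟘 ∷ []) β (𝟘 ∷ 𝟙 ∷ []) ≡ 𝟎 → α ≡ 𝟘 × β ≡ 𝟘
  coefficients 𝟘 𝟘 _ = refl , refl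
  coefficients 𝟘 𝟙 ()
  coefficients 𝟘 𝟚 ()
  coefficients 𝟙 𝟘 ()
  coefficients 𝟙 𝟙 ()
  coefficients 𝟙 𝟚 ()
  coefficients 𝟚 𝟘 ()
  coefficients 𝟚 𝟙 ()
  coefficients 𝟚 𝟚 ()
  indep : Indep (φ (𝟙 ∷ 𝟘 ∷ [])) (φ (𝟘 ∷ 𝟙 ∷ []))
  indep α β e = coefficients α β (φ-injective _ (trans (φ-lin α _ β _) e))

anyV : ∀ k → (Vec 𝔽 k → Bool) → Bool
anyV zero P = P []
anyV (suc k) P = anyV k (P ∘ (𝟘 ∷_)) ∨ (anyV k (P ∘ (𝟙 ∷_)) ∨ anyV k (P ∘ (𝟚 ∷_)))

T-∨⁻ : ∀ x {y} → T (x ∨ y) → T x ⊎ T y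
T-∨⁻ true _ = inj₁ tt
T-∨⁻ false t = inj₂ t

anyV-sound : ∀ k P → T (anyV k P) → ∃ λ v → T (P v)
anyV-sound zero P t = [] , t
anyV-sound (suc k) P t with T-∨⁻ (anyV k (P ∘ (𝟘 ∷_))) t
... | inj₁ t₀ = let v , p = anyV-sound k _ t₀ in 𝟘 ∷ v , p
... | inj₂ t₁₂ with T-∨⁻ (anyV k (P ∘ (𝟙 ∷_))) t₁₂
... | inj₁ t₁ = let v , p = anyV-sound k _ t₁ in 𝟙 ∷ v , p
... | inj₂ t₂ = let v , p = anyV-sound k _ t₂ in 𝟚 ∷ v , p

one-equation : ∀ x y → ∃₂ λ α β → ¬ (α ≡ 𝟘 × β ≡ 𝟘) × α ⊗ x ⊕ β ⊗ y ≡ 𝟘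
one-equation 𝟘 y = 𝟙 , 𝟘 , (λ ()) , refl
one-equation 𝟙 y = ⊖ y , 𝟙 , (λ ()) , brute 1 (λ { (y ∷ []) → (⊖ y) ⊗ 𝟙 ⊕ y }) (λ _ → 𝟘) tt (y ∷ [])
one-equation 𝟚 y = y , 𝟙 , (λ ()) , brute 1 (λ { (y ∷ []) → y ⊗ 𝟚 ⊕ y }) (λ _ → 𝟘) tt (y ∷ [])

solves : Vec 𝔽 6 → Vec 𝔽 3 → Bool
solves (a ∷ b ∷ c ∷ d ∷ e ∷ f ∷ []) v = not (isZero v) ∧ ((dot v (a ∷ b ∷ c ∷ []) == 𝟘) ∧ (dot v (d ∷ e ∷ f ∷ []) == 𝟘))

solves-sound : ∀ a b c d e f v → T (solves (a ∷ b ∷ c ∷ d ∷ e ∷ f ∷ []) v) →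
  isZero v ≡ false × dot v (a ∷ b ∷ c ∷ []) ≡ 𝟘 × dot v (d ∷ e ∷ f ∷ []) ≡ 𝟘
solves-sound a b c d e f v t with isZero v
... | false = let p , q = T-∧⁻ (dot v (a ∷ b ∷ c ∷ []) == 𝟘) t in refl , ==-sound _ _ p , ==-sound _ _ q

-- Two equations in three unknowns: all 3⁶ coefficient matrices are tried, with a search for a
-- nonzero solution each time.
two-equations : ∀ (x y : Vec 𝔽 3) → ∃ λ v → isZero v ≡ false × dot v x ≡ 𝟘 × dot v y ≡ 𝟘
two-equations (a ∷ b ∷ c ∷ []) (d ∷ e ∷ f ∷ []) =
  let xy = a ∷ b ∷ c ∷ d ∷ e ∷ f ∷ []
      v , p = anyV-sound 3 (solves xy) (allV-sound 6 (λ xy → anyV 3 (solves xy)) tt xy)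
  in v , solves-sound a b c d e f v p

pair-dim : ∀ {n k} {K : Vec 𝔽 n → Set} → Basis k K → Pair K → 2 ≤ k
pair-dim {k = 0} B (c , d , p , q , ind) with trivial B c p | trivial B d q
... | refl | refl = contradiction (proj₁ (ind 𝟙 𝟙 (lin-𝟎-𝟎 _))) λ ()
  where
  lin-𝟎-𝟎 : ∀ n → lin 𝟙 (𝟎 {n}) 𝟙 𝟎 ≡ 𝟎
  lin-𝟎-𝟎 zero = refl
  lin-𝟎-𝟎 (suc n) = cong (𝟘 ∷_) (lin-𝟎-𝟎 n)
pair-dim {k = 1} B (c , d , p , q , ind) with Basis.φ-surjective B c p | Basis.φ-surjective B d q
... | x ∷ [] , refl | y ∷ [] , refl =
  let α , β , nz , e = one-equation x y
  in contradiction (ind α β (trans (sym (φ-lin α _ β _)) (trans (cong (λ z → φ (z ∷ [])) e) φ-𝟎))) nz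
  where open Basis B
pair-dim {k = suc (suc k)} _ _ = s≤s (s≤s z≤n)

nul-suc : ∀ {L} t m (bs : Vec Bool L) → nul t m bs ≤ suc (nul (suc t) m bs)
nul-suc zero m [] = n≤1+n m
nul-suc zero m (false ∷ bs) = n≤1+n m
nul-suc zero zero (true ∷ bs) = z≤n
nul-suc zero (suc m) (true ∷ bs) = ≤-refl
nul-suc (suc t) m [] = n≤1+n m
nul-suc (suc t) m (false ∷ bs) = nul-suc t m bs
nul-suc (suc t) m (true ∷ bs) = nul-suc t (pred m) bs

-- Each row lowers the nullity by at most one, and there are fewer rows than columns.
nul-positive : ∀ {L} t m (bs : Vec Bool L) → t < m → nul t m bs ≢ 0
nul-positive zero m bs () refl
nul-positive (suc t) (suc m) (false ∷ bs) (s≤s lt) = nul-positive t (suc m) bs (m≤n⇒m≤1+n lt)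
nul-positive (suc t) (suc m) (true ∷ bs) (s≤s lt) = nul-positive t m bs lt
nul-positive (suc t) (suc m) [] lt ()

-- u and v together with c, which a linear functional f separates from them, span three dimensions.
triple-kill : ∀ {n} {K : Vec 𝔽 n → Set} → (∀ α u β v → K u → K v → K (lin α u β v)) →
  ∀ {u v c} → K u → K v → K c → Indep u v →
  (f : Vec 𝔽 n → 𝔽) → (∀ α u β v → f (lin α u β v) ≡ α ⊗ f u ⊕ β ⊗ f v) → f u ≡ 𝟘 → f v ≡ 𝟘 → f c ≢ 𝟘 →
  ∀ w w′ → ∃ λ x → K x × x ≢ 𝟎 × dot w x ≡ 𝟘 × dot w′ x ≡ 𝟘
triple-kill K-lin {u} {v} {c} Ku Kv Kc ind f f-lin u≡ v≡ c≢ w w′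
  with two-equations (dot w c ∷ dot w u ∷ dot w v ∷ []) (dot w′ c ∷ dot w′ u ∷ dot w′ v ∷ [])
... | a₀ ∷ a₁ ∷ a₂ ∷ [] , nz , e , e′ =
  x , K-lin a₀ c 𝟙 (lin a₁ u a₂ v) Kc (K-lin a₁ u a₂ v Ku Kv) , x≢𝟎 , trans (dot-x w) e , trans (dot-x w′) e′
  where
  open ≡-Reasoning
  x = lin a₀ c 𝟙 (lin a₁ u a₂ v)
  dot-x : ∀ w → dot w x ≡ dot (a₀ ∷ a₁ ∷ a₂ ∷ []) (dot w c ∷ dot w u ∷ dot w v ∷ [])
  dot-x w = begin
    dot w x                                          ≡⟨ dot-lin w a₀ c 𝟙 _ ⟩
    a₀ ⊗ dot w c ⊕ dot w (lin a₁ u a₂ v)             ≡⟨ cong (a₀ ⊗ dot w c ⊕_) (dot-lin w a₁ u a₂ v) ⟩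
    a₀ ⊗ dot w c ⊕ (a₁ ⊗ dot w u ⊕ a₂ ⊗ dot w v)     ≡⟨ cong (λ y → a₀ ⊗ dot w c ⊕ (a₁ ⊗ dot w u ⊕ y)) (⊕-identityʳ (a₂ ⊗ dot w v)) ⟨
    a₀ ⊗ dot w c ⊕ (a₁ ⊗ dot w u ⊕ (a₂ ⊗ dot w v ⊕ 𝟘)) ∎
  f-x : f x ≡ a₀ ⊗ f c
  f-x rewrite f-lin a₀ c 𝟙 (lin a₁ u a₂ v) | f-lin a₁ u a₂ v | u≡ | v≡ | ⊗-zeroʳ a₁ | ⊗-zeroʳ a₂ = ⊕-identityʳ _
  f-𝟎 : f 𝟎 ≡ 𝟘
  f-𝟎 = trans (cong f (sym (lin-𝟘-𝟘 𝟎 𝟎))) (f-lin 𝟘 𝟎 𝟘 𝟎)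
  zero-factor : ∀ a b → a ⊗ b ≡ 𝟘 → b ≢ 𝟘 → a ≡ 𝟘
  zero-factor 𝟘 b _ _ = refl
  zero-factor 𝟙 b e ne = contradiction e ne
  zero-factor 𝟚 𝟘 e ne = contradiction refl ne
  x≢𝟎 : x ≢ 𝟎
  x≢𝟎 x≡𝟎 with zero-factor a₀ (f c) (trans (sym f-x) (trans (cong f x≡𝟎) f-𝟎)) c≢
  ... | refl with ind a₁ a₂ (trans (sym (lin-𝟘-𝟙 c _)) x≡𝟎)
  ... | refl , refl = contradiction nz λ ()

-- Subcubes and their free coordinates

∣∣≡wt : ∀ {n} (I : Subset n) → ∣ I ∣ ≡ wt I
∣∣≡wt [] = refl
∣∣≡wt (true ∷ I) = cong suc (∣∣≡wt I)
∣∣≡wt (false ∷ I) = ∣∣≡wt I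

-- The d free coordinates of the subcube given by I and a; fill J is its vertex with value J there.
record Window {n} (I a : Vertex n) (d : ℕ) : Set where
  field
    fill : Vec Bool d → Vertex n
    base : ℕ
    π : Vec 𝔽 n → Vec 𝔽 d
    fill-∈ : ∀ J → InSubcube I a (fill J)
    wt-fill : ∀ J → wt (fill J) ≡ wt J + base
    π-lin : ∀ α u β v → π (lin α u β v) ≡ lin α (π u) β (π v)
    Supp-π : ∀ c J → Supp c (fill J) → Supp (π c) J
    Supp-fill : ∀ c J J′ → Supp c (fill J) → Supp (π c) J′ → Supp c (fill J′)

-- By recursion on the coordinates: a free one becomes an entry of `J`, and a fixed one adds its
-- value to `base`.
window : ∀ {n} (I a : Vertex n) → Window I a (wt I)
window [] [] = record
  { fill = id ; base = 0 ; π = id ; fill-∈ = λ _ () ; wt-fill = λ { [] → refl } ; π-lin = λ _ _ _ _ → refl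
  ; Supp-π = λ _ _ s → s ; Supp-fill = λ _ _ _ _ s → s }
window {suc n} (true ∷ I) (x ∷ a) = record
  { fill = λ { (b ∷ J) → b ∷ fill J }
  ; base = base
  ; π = λ { (c ∷ cs) → c ∷ π cs }
  ; fill-∈ = λ { (b ∷ J) zero ∉ → contradiction Vec.here ∉ ; (b ∷ J) (suc i) ∉ → fill-∈ J i (∉ ∘ Vec.there) }
  ; wt-fill = λ { (true ∷ J) → cong suc (wt-fill J) ; (false ∷ J) → wt-fill J }
  ; π-lin = λ { α (c ∷ u) β (d ∷ v) → cong (α ⊗ c ⊕ β ⊗ d ∷_) (π-lin α u β v) }
  ; Supp-π = λ { (c ∷ cs) (b ∷ J) s zero e → s zero e ; (c ∷ cs) (b ∷ J) s (suc i) e → Supp-π cs J (s ∘ suc) i e }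
  ; Supp-fill = λ { (c ∷ cs) (b ∷ J) (b′ ∷ J′) s s′ zero e → s′ zero e
                  ; (c ∷ cs) (b ∷ J) (b′ ∷ J′) s s′ (suc i) e → Supp-fill cs J J′ (s ∘ suc) (s′ ∘ suc) i e } }
  where open Window (window I a)
window {suc n} (false ∷ I) (x ∷ a) = record
  { fill = λ J → x ∷ fill J
  ; base = bit x + base
  ; π = λ { (c ∷ cs) → π cs }
  ; fill-∈ = λ { J zero ∉ → refl ; J (suc i) ∉ → fill-∈ J i (∉ ∘ Vec.there) }
  ; wt-fill = wt-x x
  ; π-lin = λ { α (c ∷ u) β (d ∷ v) → π-lin α u β v }
  ; Supp-π = λ { (c ∷ cs) J s i e → Supp-π cs J (s ∘ suc) i e }
  ; Supp-fill = λ { (c ∷ cs) J J′ s s′ zero e → s zero e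
                  ; (c ∷ cs) J J′ s s′ (suc i) e → Supp-fill cs J J′ (s ∘ suc) s′ i e } }
  where
  open Window (window I a)
  wt-x : ∀ x J → wt (x ∷ fill J) ≡ wt J + (bit x + base)
  wt-x true J = trans (cong suc (wt-fill J)) (sym (+-suc (wt J) base))
  wt-x false J = wt-fill J

_⊆ᵇ_ : ∀ {d} → Vec Bool d → Vec Bool d → Bool
[] ⊆ᵇ [] = true
(true ∷ A) ⊆ᵇ (false ∷ B) = false
(true ∷ A) ⊆ᵇ (true ∷ B) = A ⊆ᵇ B
(false ∷ A) ⊆ᵇ (_ ∷ B) = A ⊆ᵇ B

⊆ᵇ-sound : ∀ {d} (A B : Vec Bool d) → T (A ⊆ᵇ B) → ∀ i → lookup B i ≡ false → lookup A i ≡ false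
⊆ᵇ-sound (false ∷ A) (_ ∷ B) t zero _ = refl
⊆ᵇ-sound (true ∷ A) (true ∷ B) t (suc i) e = ⊆ᵇ-sound A B t i e
⊆ᵇ-sound (false ∷ A) (_ ∷ B) t (suc i) e = ⊆ᵇ-sound A B t i e
⊆ᵇ-sound (true ∷ A) (false ∷ B) () zero _

Supp-⊆ : ∀ {d} (c : Vec 𝔽 d) A B → T (A ⊆ᵇ B) → Supp c A → Supp c B
Supp-⊆ c A B t s i e = s i (⊆ᵇ-sound A B t i e)

Supp-drop : ∀ {d} (c : Vec 𝔽 d) J l → Supp c J → lookup c l ≡ 𝟘 → Supp c (J [ l ]≔ false)
Supp-drop c J l s e i h with i ≟ l
... | yes refl = e
... | no i≢l = s i (trans (sym (lookup∘update′ i≢l J false)) h)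

wt-drop : ∀ {d j} (J : Vec Bool d) l → lookup J l ≡ true → wt J ≡ suc j → wt (J [ l ]≔ false) ≡ j
wt-drop (true ∷ J) zero _ e = suc-injective e
wt-drop {j = suc j} (true ∷ J) (suc l) h e = cong suc (wt-drop J l h (suc-injective e))
wt-drop {j = zero} (true ∷ J) (suc l) h e = contradiction (suc-injective e) (wt≢0 J l h)
  where
  wt≢0 : ∀ {d} (J : Vec Bool d) l → lookup J l ≡ true → wt J ≢ 0
  wt≢0 (true ∷ J) l h ()
  wt≢0 (false ∷ J) (suc l) h e = wt≢0 J l h e
wt-drop (false ∷ J) (suc l) h e = wt-drop J l h e

-- Uniform matroids that are not ternary

record Subspace {n} (K : Vec 𝔽 n → Set) : Set where
  constructor closed
  field close : ∀ α u β v → K u → K v → K (lin α u β v)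

_⇒ᵇ_ : Bool → Bool → Bool
x ⇒ᵇ y = not x ∨ y

⇒ᵇ-elim : ∀ x {y} → T (x ⇒ᵇ y) → T x → T y
⇒ᵇ-elim true t _ = t

==-complete : ∀ {x y} → x ≡ y → T (x == y)
==-complete {𝟘} refl = tt
==-complete {𝟙} refl = tt
==-complete {𝟚} refl = tt

≢-complete : ∀ {x} → x ≢ 𝟘 → T (not (x == 𝟘))
≢-complete {𝟘} p = p refl
≢-complete {𝟙} _ = tt
≢-complete {𝟚} _ = tt

⊗-comm : ∀ a b → a ⊗ b ≡ b ⊗ a
⊗-comm a b = brute 2 (λ { (a ∷ b ∷ []) → a ⊗ b }) (λ { (a ∷ b ∷ []) → b ⊗ a }) tt (a ∷ b ∷ [])

-- Every nonzero element of 𝔽 is its own inverse, so equal products a b = c d are equal ratios a/b =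
-- c/d.
product-cancel : ∀ a b c d → a ≢ 𝟘 → b ≢ 𝟘 → d ≢ 𝟘 → a ⊗ b ≡ c ⊗ d → c ⊗ b ⊕ (⊖ a) ⊗ d ≡ 𝟘
product-cancel a b c d a≢ b≢ d≢ e =
  ==-sound _ _ (⇒ᵇ-elim (a ⊗ b == c ⊗ d) (⇒ᵇ-elim (not (d == 𝟘)) (⇒ᵇ-elim (not (b == 𝟘)) (⇒ᵇ-elim (not (a == 𝟘))
    (allV-sound 4 (λ { (a ∷ b ∷ c ∷ d ∷ []) → not (a == 𝟘) ⇒ᵇ (not (b == 𝟘) ⇒ᵇ (not (d == 𝟘) ⇒ᵇ
       ((a ⊗ b == c ⊗ d) ⇒ᵇ (c ⊗ b ⊕ (⊖ a) ⊗ d == 𝟘)))) }) tt (a ∷ b ∷ c ∷ d ∷ []))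
    (≢-complete a≢)) (≢-complete b≢)) (≢-complete d≢)) (==-complete e))

⊗-≢𝟘 : ∀ {a b} → a ≢ 𝟘 → b ≢ 𝟘 → a ⊗ b ≢ 𝟘
⊗-≢𝟘 {𝟘} p q = p
⊗-≢𝟘 {𝟙} p q = q
⊗-≢𝟘 {𝟚} {𝟘} p q = contradiction refl q
⊗-≢𝟘 {𝟚} {𝟙} p q ()
⊗-≢𝟘 {𝟚} {𝟚} p q ()

-- Pigeonhole on the two nonzero elements; the field having only three elements enters the matroid
-- argument here.
two-agree : ∀ a b c → a ≢ 𝟘 → b ≢ 𝟘 → c ≢ 𝟘 → a ≡ b ⊎ a ≡ c ⊎ b ≡ c
two-agree 𝟘 b c p _ _ = contradiction refl p
two-agree 𝟙 𝟘 c _ p _ = contradiction refl p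
two-agree 𝟙 𝟙 c _ _ _ = inj₁ refl
two-agree 𝟙 𝟚 𝟘 _ _ p = contradiction refl p
two-agree 𝟙 𝟚 𝟙 _ _ _ = inj₂ (inj₁ refl)
two-agree 𝟙 𝟚 𝟚 _ _ _ = inj₂ (inj₂ refl)
two-agree 𝟚 𝟘 c _ p _ = contradiction refl p
two-agree 𝟚 𝟙 𝟘 _ _ p = contradiction refl p
two-agree 𝟚 𝟙 𝟙 _ _ _ = inj₂ (inj₂ refl)
two-agree 𝟚 𝟙 𝟚 _ _ _ = inj₂ (inj₁ refl)
two-agree 𝟚 𝟚 c _ _ _ = inj₁ refl

module Sections {n d} {I a : Vertex n} (Wd : Window I a d) (K : Vec 𝔽 n → Set) (sub : Subspace K) where
  open Window Wd
  open Subspace sub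

  Section : Vec Bool d → Vec 𝔽 n → Set
  Section J c = K c × Supp c (fill J)

  infix 25 _at_
  _at_ : Vec 𝔽 n → Fin d → 𝔽
  c at i = lookup (π c) i

  coord-lin : ∀ α u β v i → (lin α u β v) at i ≡ α ⊗ u at i ⊕ β ⊗ v at i
  coord-lin α u β v i = trans (cong (λ x → lookup x i) (π-lin α u β v)) (lookup-lin i α (π u) β (π v))

  coord-out : ∀ {J c i} → Section J c → lookup J i ≡ false → c at i ≡ 𝟘
  coord-out {J} {c} {i} (_ , s) e = Supp-π c J s i e

  Section-lin : ∀ {J} α u β v → Section J u → Section J v → Section J (lin α u β v)
  Section-lin α u β v (p , s) (q , t) = close α u β v p q , λ i e →
    trans (lookup-lin i α u β v) (trans (cong₂ (λ x y → α ⊗ x ⊕ β ⊗ y) (s i e) (t i e))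
      (trans (cong (_⊕ β ⊗ 𝟘) (⊗-zeroʳ α)) (⊗-zeroʳ β)))

  Section-⊤ : ∀ {J c} → Section J c → Section (replicate d true) c
  Section-⊤ {J} {c} (p , s) = p , Supp-fill c J _ s λ i e → contradiction (trans (sym (lookup-replicate i true)) e) λ ()

  Section-shrink : ∀ {J c} J′ → Section J c → Supp (π c) J′ → Section J′ c
  Section-shrink {J} {c} J′ (p , s) t = p , Supp-fill c J J′ s t

  -- For a kernel `K`, `Trivial j` with `Nontrivial (suc j)` says that the columns indexed by the
  -- free coordinates form a uniform matroid of rank j, once the fixed coordinates with value `true`
  -- are contracted and those with value `false` deleted.
  Nontrivial : ℕ → Set
  Nontrivial j = ∀ J → wt J ≡ j → ∃ λ c → Section J c × c ≢ 𝟎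

  Trivial : ℕ → Set
  Trivial j = ∀ J → wt J ≡ j → ∀ c → Section J c → c ≡ 𝟎

  -- A zero coordinate could be removed from `J`, leaving a nonzero vector on a set of size `j`.
  coord-full : ∀ {j} → Trivial j → ∀ {J c} → wt J ≡ suc j → Section J c → c ≢ 𝟎 →
               ∀ i → lookup J i ≡ true → c at i ≢ 𝟘
  coord-full triv {J} {c} e S@(_ , s) c≢𝟎 i i∈J ci≡𝟘 =
    c≢𝟎 (triv (J [ i ]≔ false) (wt-drop J i i∈J e) c (Section-shrink _ S (Supp-drop (π c) J i (Supp-π c J s) ci≡𝟘)))

  -- The combination of u and v that vanishes at l also vanishes at l′, so it is supported on J.
  collide : ∀ {j} → Trivial j → ∀ {J₁ J₂ u v} l l′ i J → wt J ≡ j →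
    T (zipWith _∨_ J₁ J₂ ⊆ᵇ ((J [ l ]≔ true) [ l′ ]≔ true)) →
    Section J₁ u → Section J₂ v → v at l ≢ 𝟘 →
    v at l ⊗ u at l′ ⊕ (⊖ u at l) ⊗ v at l′ ≡ 𝟘 →
    u at i ≢ 𝟘 → lookup J₂ i ≡ false → ⊥
  collide triv {J₁} {J₂} {u} {v} l l′ i J e cover Su Sv vl≢ vanish ui≢ i∉J₂ =
    ⊗-≢𝟘 vl≢ ui≢ (begin
      v at l ⊗ u at i                                ≡⟨ ⊕-identityʳ _ ⟨
      v at l ⊗ u at i ⊕ 𝟘                            ≡⟨ cong (v at l ⊗ u at i ⊕_) (⊗-zeroʳ (⊖ u at l)) ⟨
      v at l ⊗ u at i ⊕ (⊖ u at l) ⊗ 𝟘            ≡⟨ cong (λ y → v at l ⊗ u at i ⊕ (⊖ u at l) ⊗ y) (coord-out Sv i∉J₂) ⟨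
      v at l ⊗ u at i ⊕ (⊖ u at l) ⊗ v at i    ≡⟨ coord-c i ⟨
      c at i                                            ≡⟨ cong (λ y → y at i) c≡𝟎 ⟩
      𝟎 at i                                            ≡⟨ coord-𝟎 i ⟩
      𝟘                                                    ∎)
    where
    open ≡-Reasoning
    c = lin (v at l) u (⊖ u at l) v
    coord-𝟎 : ∀ i → 𝟎 at i ≡ 𝟘
    coord-𝟎 i = trans (cong (λ x → x at i) (sym (lin-𝟘-𝟘 𝟎 𝟎))) (coord-lin 𝟘 𝟎 𝟘 𝟎 i)
    coord-c : ∀ k → c at k ≡ v at l ⊗ u at k ⊕ (⊖ u at l) ⊗ v at k
    coord-c = coord-lin (v at l) u (⊖ u at l) v
    supp : Supp (π c) J
    supp k k∉J with k ≟ l′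
    ... | yes refl = trans (coord-c k) vanish
    ... | no k≢l′ with k ≟ l
    ... | yes refl = trans (coord-c k)
      (brute 2 (λ { (x ∷ y ∷ []) → x ⊗ y ⊕ (⊖ y) ⊗ x }) (λ _ → 𝟘) tt (v at k ∷ u at k ∷ []))
    ... | no k≢l with lookup J₁ k in k∉J₁ | lookup J₂ k in k∉J₂ |
                      trans (sym (lookup-zipWith _∨_ k J₁ J₂))
                        (⊆ᵇ-sound (zipWith _∨_ J₁ J₂) _ cover k (trans (lookup∘update′ k≢l′ (J [ l ]≔ true) true) (trans (lookup∘update′ k≢l J true) k∉J)))
    ... | false | false | _ = trans (coord-c k)
      (trans (cong₂ (λ x y → v at l ⊗ x ⊕ (⊖ u at l) ⊗ y) (coord-out Su k∉J₁) (coord-out Sv k∉J₂))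
        (trans (cong (_⊕ (⊖ u at l) ⊗ 𝟘) (⊗-zeroʳ (v at l))) (⊗-zeroʳ (⊖ u at l))))
    c≡𝟎 : c ≡ 𝟎
    c≡𝟎 = triv J e c (Section-shrink J (Section-lin (v at l) u (⊖ u at l) v (Section-⊤ Su) (Section-⊤ Sv)) supp)


module _ {n} {I a : Vertex n} (Wd : Window I a 6) {K : Vec 𝔽 n → Set} (sub : Subspace K) where
  open Sections Wd K sub

  -- U₂,₅ is not ternary: the vectors on {0,1,2}, {0,1,3}, {0,1,4} have only two possible ratios at 0 and 1.
  -- The last coordinate is deleted if e is false and contracted if e is true.
  no-U₂,₅ : ∀ e → Trivial (2 + wt (e ∷ [])) → Nontrivial (3 + wt (e ∷ [])) → ⊥
  no-U₂,₅ e triv non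
    with non (true ∷ true ∷ true ∷ false ∷ false ∷ e ∷ []) refl
       | non (true ∷ true ∷ false ∷ true ∷ false ∷ e ∷ []) refl
       | non (true ∷ true ∷ false ∷ false ∷ true ∷ e ∷ []) refl
  ... | u , Su , u≢𝟎 | v , Sv , v≢𝟎 | w , Sw , w≢𝟎 =
    go (two-agree _ _ _ (⊗-≢𝟘 (u# (# 0) refl) (u# (# 1) refl)) (⊗-≢𝟘 (v# (# 0) refl) (v# (# 1) refl))
                        (⊗-≢𝟘 (w# (# 0) refl) (w# (# 1) refl)))
    where
    u# = coord-full triv refl Su u≢𝟎
    v# = coord-full triv refl Sv v≢𝟎
    w# = coord-full triv refl Sw w≢𝟎
    e⊆e : ∀ e → T (((e ∨ e) ∷ []) ⊆ᵇ (e ∷ []))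
    e⊆e false = tt
    e⊆e true = tt
    go : u at (# 0) ⊗ u at (# 1) ≡ v at (# 0) ⊗ v at (# 1) ⊎
         u at (# 0) ⊗ u at (# 1) ≡ w at (# 0) ⊗ w at (# 1) ⊎
         v at (# 0) ⊗ v at (# 1) ≡ w at (# 0) ⊗ w at (# 1) → ⊥
    go (inj₁ eq) = collide triv (# 0) (# 1) (# 2) (false ∷ false ∷ true ∷ true ∷ false ∷ e ∷ []) refl (e⊆e e) Su Sv
      (v# (# 0) refl) (product-cancel (u at (# 0)) (u at (# 1)) (v at (# 0)) (v at (# 1)) (u# (# 0) refl) (u# (# 1) refl) (v# (# 1) refl) eq) (u# (# 2) refl) refl
    go (inj₂ (inj₁ eq)) = collide triv (# 0) (# 1) (# 2) (false ∷ false ∷ true ∷ false ∷ true ∷ e ∷ []) refl (e⊆e e) Su Sw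
      (w# (# 0) refl) (product-cancel (u at (# 0)) (u at (# 1)) (w at (# 0)) (w at (# 1)) (u# (# 0) refl) (u# (# 1) refl) (w# (# 1) refl) eq) (u# (# 2) refl) refl
    go (inj₂ (inj₂ eq)) = collide triv (# 0) (# 1) (# 3) (false ∷ false ∷ false ∷ true ∷ true ∷ e ∷ []) refl (e⊆e e) Sv Sw
      (w# (# 0) refl) (product-cancel (v at (# 0)) (v at (# 1)) (w at (# 0)) (w at (# 1)) (v# (# 0) refl) (v# (# 1) refl) (w# (# 1) refl) eq) (v# (# 3) refl) refl

  -- Dually, the vectors on {0,1,2,3} and {0,1,2,4} are proportional at two of the coordinates 0, 1, 2.
  no-U₃,₅ : Trivial 4 → Nontrivial 5 → ⊥
  no-U₃,₅ triv non
    with non (true ∷ true ∷ true ∷ true ∷ false ∷ true ∷ []) refl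
       | non (true ∷ true ∷ true ∷ false ∷ true ∷ true ∷ []) refl
  ... | u , Su , u≢𝟎 | v , Sv , v≢𝟎 =
    go (two-agree _ _ _ (⊗-≢𝟘 (u# (# 0) refl) (v# (# 0) refl)) (⊗-≢𝟘 (u# (# 1) refl) (v# (# 1) refl))
                        (⊗-≢𝟘 (u# (# 2) refl) (v# (# 2) refl)))
    where
    u# = coord-full triv refl Su u≢𝟎
    v# = coord-full triv refl Sv v≢𝟎
    vanish : ∀ l l′ → u at l ≢ 𝟘 → v at l ≢ 𝟘 → v at l′ ≢ 𝟘 →
             u at l ⊗ v at l ≡ u at l′ ⊗ v at l′ →
             v at l ⊗ u at l′ ⊕ (⊖ u at l) ⊗ v at l′ ≡ 𝟘
    vanish l l′ p q r eq =
      trans (cong (_⊕ (⊖ u at l) ⊗ v at l′) (⊗-comm (v at l) (u at l′))) (product-cancel (u at l) (v at l) (u at l′) (v at l′) p q r eq)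
    go : u at (# 0) ⊗ v at (# 0) ≡ u at (# 1) ⊗ v at (# 1) ⊎
         u at (# 0) ⊗ v at (# 0) ≡ u at (# 2) ⊗ v at (# 2) ⊎
         u at (# 1) ⊗ v at (# 1) ≡ u at (# 2) ⊗ v at (# 2) → ⊥
    go (inj₁ eq) = collide triv (# 0) (# 1) (# 3) (false ∷ false ∷ true ∷ true ∷ true ∷ true ∷ []) refl tt Su Sv
      (v# (# 0) refl) (vanish (# 0) (# 1) (u# (# 0) refl) (v# (# 0) refl) (v# (# 1) refl) eq) (u# (# 3) refl) refl
    go (inj₂ (inj₁ eq)) = collide triv (# 0) (# 2) (# 3) (false ∷ true ∷ false ∷ true ∷ true ∷ true ∷ []) refl tt Su Sv
      (v# (# 0) refl) (vanish (# 0) (# 2) (u# (# 0) refl) (v# (# 0) refl) (v# (# 2) refl) eq) (u# (# 3) refl) refl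
    go (inj₂ (inj₂ eq)) = collide triv (# 1) (# 2) (# 3) (true ∷ false ∷ false ∷ true ∷ true ∷ true ∷ []) refl tt Su Sv
      (v# (# 1) refl) (vanish (# 1) (# 2) (u# (# 1) refl) (v# (# 1) refl) (v# (# 2) refl) eq) (u# (# 3) refl) refl

-- Indexed by i, where 2 + i is the position of the layer t in the copy of Q₆.
data Middle : ℕ → Set where
  two : Middle 0
  three : Middle 1
  four : Middle 2

-- Deleting an element takes U₂,₆ to U₂,₅; contracting one takes U₃,₆ to U₂,₅ and U₄,₆ to U₃,₅.
no-uniform : ∀ {n} {I a : Vertex n} (Wd : Window I a 6) {K : Vec 𝔽 n → Set} (sub : Subspace K) {i} → Middle i →
  Sections.Trivial Wd K sub (2 + i) → Sections.Nontrivial Wd K sub (3 + i) → ⊥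
no-uniform Wd sub two = no-U₂,₅ Wd sub false
no-uniform Wd sub three = no-U₂,₅ Wd sub true
no-uniform Wd sub four = no-U₃,₅ Wd sub

-- Connectivity of a layer under exchanges

-- The revolving-door order: consecutive subsets of the same size differ by one exchange.
gray : ∀ n → ℕ → List (Vec Bool n)
gray n zero = List.[ replicate n false ]
gray zero (suc k) = List.[]
gray (suc n) (suc k) = List.map (false ∷_) (gray n (suc k)) List.++ List.map (true ∷_) (List.reverse (gray n k))

-- Stated as an inclusion, this is what moves a vector on `J′` that vanishes at `l` to `J`.
Exchange : ∀ {d} → Vec Bool d → Vec Bool d → Set
Exchange J J′ = ∃ λ l → T ((J′ [ l ]≔ false) ⊆ᵇ J)

exchange? : ∀ {d} (J J′ : Vec Bool d) → Dec (Exchange J J′)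
exchange? J J′ = any? (λ l → T? ((J′ [ l ]≔ false) ⊆ᵇ J))

data Chain {d} (k : ℕ) : Vec Bool d → List (Vec Bool d) → Set where
  end : ∀ {J} → Chain k J List.[]
  link : ∀ {J J′ Js} → wt J′ ≡ k → Exchange J J′ → Exchange J′ J → Chain k J′ Js → Chain k J (J′ List.∷ Js)

chain? : ∀ {d} k (J : Vec Bool d) Js → Dec (Chain k J Js)
chain? k J List.[] = yes end
chain? k J (J′ List.∷ Js) with wt J′ ℕ.≟ k | exchange? J J′ | exchange? J′ J | chain? k J′ Js
... | yes p | yes q | yes r | yes s = yes (link p q r s)
... | no p | _ | _ | _ = no λ { (link p′ _ _ _) → p p′ }
... | yes _ | no q | _ | _ = no λ { (link _ q′ _ _) → q q′ }
... | yes _ | yes _ | no r | _ = no λ { (link _ _ r′ _) → r r′ }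
... | yes _ | yes _ | yes _ | no s = no λ { (link _ _ _ s′) → s s′ }

allB? : ∀ d {P : Vec Bool d → Set} → (∀ J → Dec (P J)) → Dec (∀ J → P J)
allB? zero P? = map′ (λ { p [] → p }) (λ f → f []) (P? [])
allB? (suc d) P? = map′ (λ { (p , q) (false ∷ J) → p J ; (p , q) (true ∷ J) → q J })
  (λ f → f ∘ (false ∷_) , f ∘ (true ∷_)) (allB? d (P? ∘ (false ∷_)) ×-dec allB? d (P? ∘ (true ∷_)))

module _ {d k} {P : Vec Bool d → Set} (step : ∀ J J′ → wt J ≡ k → wt J′ ≡ k → Exchange J J′ → P J → P J′) where

  from-head : ∀ {J Js J′} → wt J ≡ k → Chain k J Js → J′ ∈ J List.∷ Js → P J → P J′
  from-head w c (here refl) p = p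
  from-head w (link w′ e _ c) (there m) p = from-head w′ c m (step _ _ w w′ e p)

  to-head : ∀ {J Js J′} → wt J ≡ k → Chain k J Js → J′ ∈ J List.∷ Js → P J′ → P J
  to-head w c (here refl) p = p
  to-head w (link w′ _ e c) (there m) p = step _ _ w′ w e (to-head w′ c m p)

prefix : ∀ d → ℕ → Vec Bool d
prefix zero k = []
prefix (suc d) zero = false ∷ prefix d zero
prefix (suc d) (suc k) = true ∷ prefix d k

wt-prefix : ∀ {i} → Middle i → wt (prefix 6 (2 + i)) ≡ 2 + i
wt-prefix two = refl
wt-prefix three = refl
wt-prefix four = refl

wt-prefix₂ : ∀ {i} → Middle i → wt (prefix 6 i) ≡ i
wt-prefix₂ two = refl
wt-prefix₂ three = refl
wt-prefix₂ four = refl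

prefix-⊆ : ∀ {i} → Middle i → T (prefix 6 i ⊆ᵇ prefix 6 (2 + i))
prefix-⊆ two = tt
prefix-⊆ three = tt
prefix-⊆ four = tt

member : ∀ {d k} (J : Vec Bool d) → wt J ≡ suc k → ∃ λ l → lookup J l ≡ true
member (true ∷ J) _ = zero , refl
member (false ∷ J) e = let l , p = member J e in suc l , p

-- The Gray code lists the whole layer, and its consecutive members are exchanges in both
-- directions; both facts are decided by evaluation. So the property travels from `J` back to the
-- head of the list and from there to `J′`.
connected : ∀ {i} → Middle i → {P : Vec Bool 6 → Set} →
  (∀ J J′ → wt J ≡ 2 + i → wt J′ ≡ 2 + i → Exchange J J′ → P J → P J′) →
  ∀ J J′ → wt J ≡ 2 + i → wt J′ ≡ 2 + i → P J → P J′
connected {i} mid step J J′ w w′ p with gray 6 (2 + i) | facts mid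
  where
  Facts : ℕ → List (Vec Bool 6) → Set
  Facts k List.[] = ⊥
  Facts k (J List.∷ Js) = wt J ≡ k × Chain k J Js × (∀ J′ → wt J′ ≡ k → J′ ∈ J List.∷ Js)
  facts? : ∀ k Js → Dec (Facts k Js)
  facts? k List.[] = no λ ()
  facts? k (J List.∷ Js) = (wt J ℕ.≟ k) ×-dec (chain? k J Js ×-dec allB? 6 (λ J′ → (wt J′ ℕ.≟ k) →-dec (J′ ∈? (J List.∷ Js))))
    where open DecMembership (≡-dec Bool._≟_) using (_∈?_)
  facts : ∀ {i} → Middle i → Facts (2 + i) (gray 6 (2 + i))
  facts two = toWitness {a? = facts? 2 (gray 6 2)} tt
  facts three = toWitness {a? = facts? 3 (gray 6 3)} tt
  facts four = toWitness {a? = facts? 4 (gray 6 4)} tt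
... | J₀ List.∷ Js | w₀ , chain , complete =
  from-head step w₀ chain (complete J′ w′) (to-head step w₀ chain (complete J w) p)

-- Absence of copies of Q₆

zero-or-not : ∀ x → x ≡ 𝟘 ⊎ x ≢ 𝟘
zero-or-not 𝟘 = inj₁ refl
zero-or-not 𝟙 = inj₂ λ ()
zero-or-not 𝟚 = inj₂ λ ()

-- Positions 2, 3 and 4 have consecutive sizes, so they cover all residues modulo 3.
main-phase : ∀ o s → ∃ λ i → Middle i × phase o (2 + i + s) ≡ main
main-phase o s with phase o s in eq
... | main = 1 , three , cong (next ∘ next ∘ next) eq
... | guard = 0 , two , cong (next ∘ next) eq
... | free = 2 , four , cong (next ∘ next ∘ next ∘ next) eq

next²-main : ∀ p → next (next p) ≡ main → p ≡ guard
next²-main guard _ = refl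

module _ {n L} (M : Vec (Vec 𝔽 n) L) where

  kernel : ∀ t → Subspace (Ker t M)
  kernel t = closed (Ker-lin t M)

  ν-trivial : ∀ t X → ν t M X ≡ 0 → ∀ c → Ker t M c × Supp c X → c ≡ 𝟎
  ν-trivial t X e = trivial (subst (λ k → Basis k (λ c → Ker t M c × Supp c X)) e (Ker-basis-on t M X))

  ν-nontrivial : ∀ t X → ν t M X ≢ 0 → ∃ λ c → (Ker t M c × Supp c X) × c ≢ 𝟎
  ν-nontrivial t X ne with ν t M X | Ker-basis-on t M X
  ... | zero | _ = contradiction refl ne
  ... | suc k | B = nontrivial B

  ν-pair : ∀ t X → ν t M X ≡ 2 → Pair (λ c → Ker t M c × Supp c X)
  ν-pair t X e = pair (subst (λ k → Basis k (λ c → Ker t M c × Supp c X)) e (Ker-basis-on t M X))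

  main-layer : ∀ o X {k} → wt X ≡ k → phase o k ≡ main → family M o X ≡ true →
               ν k M X ≡ 0 ⊎ (ν k M X ≡ 2 × ν (2 + k) M X ≡ 0)
  main-layer o X refl ph X∈S rewrite ph with ν (wt X) M X | ν (2 + wt X) M X
  ... | 0 | _ = inj₁ refl
  ... | 2 | 0 = inj₂ (refl , refl)

  guard-layer : ∀ o X {k} → wt X ≡ k → phase o k ≡ guard → family M o X ≡ true →
                ν (2 + k) M X ≡ 2 → ν (4 + k) M X ≢ 0
  guard-layer o X refl ph X∈S e₂ e₄ rewrite ph | e₂ | e₄ = contradiction X∈S λ ()

  module Copy (o : Phase) {I a : Vertex n} (Wd : Window I a 6)
              (inside : ∀ x → InSubcube I a x → family M o x ≡ true)
              {i} (mid : Middle i) (phase-t : phase o (2 + i + Window.base Wd) ≡ main) where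
    open Window Wd

    t : ℕ
    t = 2 + i + base

    J₀ : Vec Bool 6
    J₀ = prefix 6 (2 + i)

    module K₀ = Sections Wd (Ker t M) (kernel t)
    module K₂ = Sections Wd (Ker (2 + t) M) (kernel (2 + t))
    open K₀ using (_at_)

    wt-fill′ : ∀ {k} J → wt J ≡ k → wt (fill J) ≡ k + base
    wt-fill′ J e = trans (wt-fill J) (cong (_+ base) e)

    types : ∀ J → wt J ≡ 2 + i → ν t M (fill J) ≡ 0 ⊎ (ν t M (fill J) ≡ 2 × ν (2 + t) M (fill J) ≡ 0)
    types J e = main-layer o (fill J) (wt-fill′ J e) phase-t (inside (fill J) (fill-∈ J))

    -- The nullity cannot jump from 0 to 2: some nontrivial combination of two independent vectors
    -- on `J′` vanishes at the exchanged `l`, hence lives on `J`, where the kernel is trivial.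
    exchange-step : ∀ J J′ → wt J ≡ 2 + i → wt J′ ≡ 2 + i → Exchange J J′ → ν t M (fill J) ≡ 0 → ν t M (fill J′) ≡ 0
    exchange-step J J′ w w′ (l , sub) e with types J′ w′
    ... | inj₁ e′ = e′
    ... | inj₂ (e′ , _) with ν-pair t (fill J′) e′
    ... | u , v , Su , Sv , ind with one-equation (u at l) (v at l)
    ... | α , β , nz , eq = contradiction (ind α β (ν-trivial t (fill J) e c (K₀.Section-shrink J Sc supp))) nz
      where
      c = lin α u β v
      Sc : K₀.Section J′ c
      Sc = K₀.Section-lin α u β v Su Sv
      supp : Supp (π c) J
      supp = Supp-⊆ (π c) (J′ [ l ]≔ false) J sub
        (Supp-drop (π c) J′ l (Supp-π c J′ (proj₂ Sc)) (trans (K₀.coord-lin α u β v l) eq))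

    -- Sets of size t + 1 are dependent simply because there are only t rows, so the matroid would
    -- be uniform.
    type-I : (∀ J → wt J ≡ 2 + i → ν t M (fill J) ≡ 0) → ⊥
    type-I all = no-uniform Wd (kernel t) mid
      (λ J e → ν-trivial t (fill J) (all J e))
      (λ J e → ν-nontrivial t (fill J) (nul-positive t (wt (fill J)) (profile M (fill J)) (≤-reflexive (sym (wt-fill′ J e)))))

    module _ (all : ∀ J → wt J ≡ 2 + i → ν t M (fill J) ≡ 2 × ν (2 + t) M (fill J) ≡ 0) where

      module _ (J′ : Vec Bool 6) (w′ : wt J′ ≡ 3 + i) (e′ : ν (2 + t) M (fill J′) ≡ 0) where

        Section-undrop : ∀ {l c} → K₀.Section (J′ [ l ]≔ false) c → K₀.Section J′ c
        Section-undrop {l} {c} S = K₀.Section-shrink J′ S λ k k∉J′ → Supp-π c (J′ [ l ]≔ false) (proj₂ S) k (drop k k∉J′)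
          where
          drop : ∀ k → lookup J′ k ≡ false → lookup (J′ [ l ]≔ false) k ≡ false
          drop k k∉J′ with k ≟ l
          ... | yes refl = lookup∘update l J′ false
          ... | no k≢l = trans (lookup∘update′ k≢l J′ false) k∉J′

        -- If `c` were nonzero at `l` in `J′`, then `c` and an independent pair on `J′` without `l`
        -- would span three dimensions. Two further rows cannot kill all of them, contrary to `e′`.
        vanish : ∀ c → K₀.Section J′ c → ∀ l → c at l ≡ 𝟘
        vanish c Sc l with lookup J′ l in l∈J′ | zero-or-not (c at l)
        ... | false | _ = Supp-π c J′ (proj₂ Sc) l l∈J′
        ... | true | inj₁ e = e
        ... | true | inj₂ cl≢𝟘 with ν-pair t (fill (J′ [ l ]≔ false)) (proj₁ (all (J′ [ l ]≔ false) (wt-drop J′ l l∈J′ w′)))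
        ... | u , v , Su , Sv , ind
          with Ker-suc t M | Ker-suc (1 + t) M
        ... | r , suc-r | r′ , suc-r′
          with triple-kill {K = K₀.Section J′} K₀.Section-lin {u} {v} {c} (Section-undrop Su) (Section-undrop Sv) Sc ind
                 (_at l) (λ α u β v → K₀.coord-lin α u β v l)
                 (Supp-π u (J′ [ l ]≔ false) (proj₂ Su) l (lookup∘update l J′ false))
                 (Supp-π v (J′ [ l ]≔ false) (proj₂ Sv) l (lookup∘update l J′ false)) cl≢𝟘 r r′
        ... | x , (Kx , Sx) , x≢𝟎 , rx , r′x =
          contradiction (ν-trivial (2 + t) (fill J′) e′ x (suc-r′ x (suc-r x Kx rx) r′x , Sx)) x≢𝟎

        J₂ : Vec Bool 6
        J₂ = prefix 6 i

        to-J₂ : ∀ {c} → K₀.Section J′ c → K₀.Section J₂ c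
        to-J₂ {c} S = K₀.Section-shrink J₂ S (λ l _ → vanish c S l)

        -- The set `J₂` lies in `J₀`, whose kernel for the first t + 2 rows is already trivial.
        ν₂-J₂ : ν (2 + t) M (fill J₂) ≡ 0
        ν₂-J₂ with ν (2 + t) M (fill J₂) ℕ.≟ 0
        ... | yes e = e
        ... | no ne with ν-nontrivial (2 + t) (fill J₂) ne
        ... | c , Sc , c≢𝟎 = contradiction
          (ν-trivial (2 + t) (fill J₀) (proj₂ (all J₀ (wt-prefix mid))) c
            (K₂.Section-shrink J₀ Sc (Supp-⊆ (π c) J₂ J₀ (prefix-⊆ mid) (Supp-π c J₂ (proj₂ Sc))))) c≢𝟎

        -- At least 2, since by `vanish` an independent pair on `J′` is supported on the fixed
        -- coordinates and so fits into `J₂`; at most 2, since two more rows bring the nullity down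
        -- to 0.
        ν₀-J₂ : ν t M (fill J₂) ≡ 2
        ν₀-J₂ with member J′ w′
        ... | l , l∈J′ with ν-pair t (fill (J′ [ l ]≔ false)) (proj₁ (all (J′ [ l ]≔ false) (wt-drop J′ l l∈J′ w′)))
        ... | u , v , Su , Sv , ind = ≤-antisym
          (≤-trans (nul-suc t (wt (fill J₂)) bs)
            (s≤s (≤-trans (nul-suc (1 + t) (wt (fill J₂)) bs) (s≤s (≤-reflexive ν₂-J₂)))))
          (pair-dim (Ker-basis-on t M (fill J₂)) (u , v , to-J₂ (Section-undrop Su) , to-J₂ (Section-undrop Sv) , ind))
          where bs = profile M (fill J₂)

        guarded : ⊥
        guarded = guard-layer o (fill J₂) (wt-fill′ J₂ (wt-prefix₂ mid)) (next²-main _ phase-t)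
          (inside (fill J₂) (fill-∈ J₂)) ν₀-J₂ ν₂-J₂

      -- A set one element larger that is independent for t + 2 rows is excluded by `guarded`,
      -- because `fill J₂` would be a discarded set of size t - 2. Without such a set, the first t +
      -- 2 rows give a uniform matroid.
      type-II : ⊥
      type-II = no-uniform Wd (kernel (2 + t)) mid
        (λ J e → ν-trivial (2 + t) (fill J) (proj₂ (all J e)))
        (λ J e → ν-nontrivial (2 + t) (fill J) (guarded J e))

    impossible : ⊥
    impossible with types J₀ (wt-prefix mid)
    ... | inj₁ e = type-I (λ J w → connected mid exchange-step J₀ J (wt-prefix mid) w e)
    ... | inj₂ (e , _) = type-II all
      where
      all : ∀ J → wt J ≡ 2 + i → ν t M (fill J) ≡ 2 × ν (2 + t) M (fill J) ≡ 0
      all J w with types J w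
      ... | inj₂ p = p
      -- Nullity 0 at `J` would spread to `J₀`, where it is 2.
      ... | inj₁ e₀ = contradiction (trans (sym e) (connected mid exchange-step J J₀ w (wt-prefix mid) e₀)) λ ()

  family-free : ∀ o → QdFree 6 (family M o)
  family-free o (I , a , ∣I∣≡6 , inside) =
    let Wd = subst (Window I a) (trans (sym (∣∣≡wt I)) ∣I∣≡6) (window I a)
        i , mid , ph = main-phase o (Window.base Wd)
    in Copy.impossible o Wd inside mid ph

theorem6 : Σ ℕ λ p → Σ ℕ λ q → (6 * q < 7 * p) ×
    Σ ℕ λ N → (n : ℕ) → N ≤ n →
    Σ (VSet n) λ S → QdFree 6 S × (p * 2 ^ n ≤ q * size S)
-- The summand 2000 comes from the free phase and the factor 3 from averaging over the offsets.
-- Since 7 · 5143 = 36001 exceeds 6 · 6000 by exactly one, `≤-refl` proves the strict inequality.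
-- The construction works from n = 0 on.
theorem6 = 3143 + 2000 , 3 * 2000 , ≤-refl , 0 , λ n _ →
  let M , o , dense = dense-family n (4 + n)
        (λ X → subst (λ k → Bound 3143 2000 (wt X) (4 + k)) (wt+co X) (score-bound (wt X) (co X)))
  in family M o , family-free M o , dense
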